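{- For every integer $\alpha\ge 1$, as congruences between formal power series in $q$ with integer coefficients (coefficientwise), \[ \sum_{n\ge0}\overline{p}_3(3^{2\alpha}n)(-q)^n\equiv \frac{\varphi(q^3)^4}{\varphi(q)^7}\pmod{9\cdot 2^3}, \qquad \sum_{n\ge0}\overline{p}_3(3^{2\alpha+1}n)(-q)^n\equiv \frac{\varphi(q^3)^5}{\varphi(q)^8}\pmod{9\cdot 2^3}. \]
   Context: $\overline{p}_3(n)$ denotes the number of overpartition triples of $n$ (triples of overpartitions whose parts together sum to $n$, where an overpartition is a partition in which the first occurrence of each distinct part may be overlined), with $\overline{p}_3(0)=1$; equivalently $\sum_{n\ge0}\overline{p}_3(n)q^n=1/\varphi(-q)^3$, where $\varphi(q)=\sum_{n=-\infty}^{\infty}q^{n^2}$. -}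

module Defs where

open import Data.Nat as ℕ using (ℕ; zero; suc; _∸_; _≟_; _%_; _/_)
open import Data.Integer as ℤ using (ℤ; +_; -_; _+_; _*_; _-_)
open import Data.Integer.Divisibility using (_∣_)
open import Data.List using (List; []; _∷_)
open import Relation.Nullary.Decidable using (does)
open import Data.Bool using (if_then_else_)

-- Formal power series in q with integer coefficients: n ↦ coefficient of q^n.
PS : Set
PS = ℕ → ℤ

sumTo : ℕ → (ℕ → ℤ) → ℤ
sumTo zero    f = f 0
sumTo (suc n) f = sumTo n f + f (suc n)

infixl 7 _⊛_
infixr 8 _^^_
infix 4 _≡[mod_]_

_⊛_ : PS → PS → PS
(f ⊛ g) n = sumTo n (λ k → f k * g (n ∸ k))

one : PS
one zero    = + 1
one (suc _) = + 0

_^^_ : PS → ℕ → PS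
f ^^ zero  = one
f ^^ suc k = f ⊛ (f ^^ k)

-- φ(q) = Σ_{k ∈ ℤ} q^{k²}: coefficient of q^n is #{k ∈ ℤ : k² = n}
-- = Σ_{j=0}^{n} [j² = n]·(1 if j = 0 else 2).
φ : PS
φ n = sumTo n (λ j → if does (j ℕ.* j ≟ n)
                       then (if does (j ≟ 0) then + 1 else + 2)
                       else + 0)

sub3 : PS → PS
sub3 f n = if does (n % 3 ≟ 0) then f (n / 3) else + 0

sgn : ℕ → ℤ
sgn zero    = + 1
sgn (suc n) = - sgn n

subNeg : PS → PS
subNeg f n = sgn n * f n

-- Multiplicative inverse of a power series with constant term 1:
-- g 0 = 1, g n = - Σ_{k=1}^{n} f k · g (n-k).
-- invList f n = g n ∷ g (n-1) ∷ … ∷ g 0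
private
  conv : PS → List ℤ → ℤ
  conv f []       = + 0
  conv f (x ∷ xs) = f 1 * x + conv (λ k → f (suc k)) xs

  invList : PS → ℕ → List ℤ
  invList f zero    = + 1 ∷ []
  invList f (suc n) = let gs = invList f n in (- conv f gs) ∷ gs

  headOr0 : List ℤ → ℤ
  headOr0 []      = + 0
  headOr0 (x ∷ _) = x

inv : PS → PS
inv f n = headOr0 (invList f n)

-- Σ_{n≥0} p̄₃(n) q^n = 1/φ(-q)^3
pbar3 : ℕ → ℤ
pbar3 = inv (subNeg φ ^^ 3)

_≡[mod_]_ : PS → ℕ → PS → Set
f ≡[mod m ] g = ∀ n → (+ m) ∣ (f n - g n)

{-# OPTIONS --safe #-}
module Submission where

open import Defs
open import Data.Nat using (ℕ; _*_; _^_; _+_; _≤_)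
open import Data.Integer using () renaming (_*_ to _*ℤ_)
open import Data.Product using (_×_)
open import Algebra.Bundles using (CommutativeRing)
open import Algebra.Solver.Ring.AlmostCommutativeRing using (fromCommutativeRing; _-Raw-AlmostCommutative⟶_)
open import Algebra.Structures using (IsCommutativeRing)
open import Data.Bool using (if_then_else_; true; false)
open import Data.Empty using (⊥-elim)
open import Data.Integer as ℤ using (ℤ; +_; -_; -[1+_]; 0ℤ; 1ℤ; ∣_∣)
import Data.Integer.DivMod as ℤDivMod
open import Data.Integer.Divisibility.Signed as Signed
  using (_∣_; _∣?_; divides; ∣m∣n⇒∣m+n; ∣m∣n⇒∣m-n; ∣m⇒∣-m; ∣⇒∣ᵤ; ∣ᵤ⇒∣)
import Data.Integer.Properties as ℤₚ
open import Data.Integer.Tactic.RingSolver using (solve-∀)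
open import Data.List using (List; []; _∷_; _++_; length; map; filter; cartesianProduct)
open import Data.List.Membership.Propositional using (_∈_)
open import Data.List.Membership.Propositional.Properties
  using (∈-map⁺; ∈-map⁻; ∈-filter⁺; ∈-filter⁻; ∈-cartesianProduct⁺)
open import Data.List.Membership.Propositional.Properties.WithK using (unique∧set⇒bag)
open import Data.List.Properties using (length-map)
open import Data.List.Relation.Binary.BagAndSetEquality using (∼bag⇒↭)
open import Data.List.Relation.Binary.Permutation.Propositional.Properties using (↭-length)
open import Data.List.Relation.Unary.All as All using (All; []; _∷_)
open import Data.List.Relation.Unary.AllPairs using ([]; _∷_)
open import Data.List.Relation.Unary.Any using (here; there)
open import Data.List.Relation.Unary.Unique.Propositional using (Unique)
import Data.List.Relation.Unary.Unique.Propositional.Properties as Unique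
open import Data.Maybe using (Maybe; just; nothing)
open import Data.Nat as ℕ using (zero; suc; _∸_; z≤n; s≤s; _%_; _≟_)
open import Data.Nat.Coprimality using (coprime?; coprime-divisor)
import Data.Nat.DivMod as DivMod
import Data.Nat.Divisibility as ℕ∣
import Data.Nat.Properties as ℕₚ
open import Data.Nat.Tactic.RingSolver using () renaming (solve-∀ to ℕ-solve-∀)
open import Data.Product using (_,_; ∃; proj₁; proj₂)
open import Data.Sum using (_⊎_; inj₁; inj₂)
open import Function using (_∘_)
open import Function.Bundles using (mk⇔)
open import Level using (0ℓ)
import Relation.Binary.Reasoning.Setoid as SetoidReasoning
open import Relation.Binary.PropositionalEquality
open import Relation.Nullary using (¬_; Dec; does; yes; no; _because_)
open import Relation.Nullary.Decidable using (_×-dec_; dec-true; dec-false; does-⇔; from-yes; from-no)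
open import Algebra.Properties.AbelianGroup ℤₚ.+-0-abelianGroup using (∙-cancelˡ; ∙-cancelʳ)

-- Write a = φ(q³), φ = a(q³) + q β(q³) and U(Σ cₙ qⁿ) = Σ c₃ₙ qⁿ, so that U(f(q³) g) = f U(g), U(φ) = a, U(a) = φ.
--
-- Modulo 8, φ⁴ ≡ a⁴ ≡ 1, hence 1/φ³ ≡ φ, and U alternates between φ and a.
--
-- Modulo 9, φ³ ≡ a (mod 3) gives φ⁹ ≡ a³, hence 1/φ³ ≡ φ⁶/a³ and U(1/φ³) ≡ U(φ⁶)/φ³. With N = a³ + q β³ one has
-- U(φ⁶) ≡ N² and U(φ⁵) ≡ a² N. The identity φ⁴ = a N then yields U²(1/φ³) ≡ a φ², after which U alternates
-- between a φ² and a² φ.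
--
-- The identity φ⁴ = a N counts lattice vectors: a conference matrix of order 4 multiplies norms by 3 and maps ℤ⁴ onto
-- the vectors whose reduction modulo 3 lies in the tetracode, whose weight enumerator is x⁴ + 8 x y³.

-- Formal power series

-- The operator U passes through series in q³ but not through 1/φ³, so 1/φ³ has to be traded for a
-- positive power of φ over a power of a. Positive powers are expanded by the dissection; this
-- brings in N, and only an exact relation between N and φ can eliminate it again. The dissection
-- alone does not give that relation: U(φ⁴) = a⁴ + 4 a q β³, which is not a N. The lattice supplies
-- it. Put A = a(q³) and B = q β(q³), the theta series of the multiples of 3 and of the integers
-- prime to 3. A single nonzero class modulo 3 has theta series B/2, so the tetracode gives A⁴ + 8 A
-- (B/2)³ = A⁴ + A B³, and U of this is a N. The conference matrix identifies that lattice with ℤ⁴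
-- scaled by √3, whose theta series is φ(q³)⁴. Sums over ℤ⁴ are infinite. They are replaced, one
-- coefficient at a time, by finite sums over a box large enough for the degree in question, and the
-- truncated theta series are compared with φ only up to that degree.

infixl 6 _∔_

_∔_ : PS → PS → PS
(f ∔ g) n = f n ℤ.+ g n

const : ℤ → PS
const c zero    = c
const c (suc _) = 0ℤ

const-0 : const 0ℤ ≗ λ _ → 0ℤ
const-0 zero    = refl
const-0 (suc _) = refl

shift : PS → PS
shift f zero    = 0ℤ
shift f (suc n) = f n

X : PS
X = shift one

sumTo-cong : ∀ n {f g : PS} → (∀ k → k ℕ.≤ n → f k ≡ g k) → sumTo n f ≡ sumTo n g
sumTo-cong zero    h = h 0 z≤n
sumTo-cong (suc n) h =
  cong₂ ℤ._+_ (sumTo-cong n λ k k≤n → h k (ℕₚ.m≤n⇒m≤1+n k≤n)) (h (suc n) ℕₚ.≤-refl)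

sumTo-suc : ∀ n (f : PS) → sumTo (suc n) f ≡ f 0 ℤ.+ sumTo n (f ∘ suc)
sumTo-suc zero    f = refl
sumTo-suc (suc n) f = trans (cong (ℤ._+ f (2 ℕ.+ n)) (sumTo-suc n f)) (ℤₚ.+-assoc (f 0) _ _)

sumTo-∔ : ∀ n (f g : PS) → sumTo n (f ∔ g) ≡ sumTo n f ℤ.+ sumTo n g
sumTo-∔ zero    f g = refl
sumTo-∔ (suc n) f g = trans (cong (ℤ._+ (f ∔ g) (suc n)) (sumTo-∔ n f g))
  (interchange (sumTo n f) (sumTo n g) (f (suc n)) (g (suc n)))
  where
  interchange : ∀ a b c d → (a ℤ.+ b) ℤ.+ (c ℤ.+ d) ≡ (a ℤ.+ c) ℤ.+ (b ℤ.+ d)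
  interchange = solve-∀

sumTo-*ˡ : ∀ n c (f : PS) → sumTo n (λ k → c ℤ.* f k) ≡ c ℤ.* sumTo n f
sumTo-*ˡ zero    c f = refl
sumTo-*ˡ (suc n) c f =
  trans (cong (ℤ._+ c ℤ.* f (suc n)) (sumTo-*ˡ n c f)) (sym (ℤₚ.*-distribˡ-+ c _ _))

sumTo-zero : ∀ n {f : PS} → (∀ k → k ℕ.≤ n → f k ≡ 0ℤ) → sumTo n f ≡ 0ℤ
sumTo-zero zero    h = h 0 z≤n
sumTo-zero (suc n) h =
  cong₂ ℤ._+_ (sumTo-zero n λ k k≤n → h k (ℕₚ.m≤n⇒m≤1+n k≤n)) (h (suc n) ℕₚ.≤-refl)

sumTo-reverse : ∀ n (f : PS) → sumTo n f ≡ sumTo n (λ k → f (n ∸ k))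
sumTo-reverse zero    f = refl
sumTo-reverse (suc n) f = begin
  sumTo (suc n) f                                      ≡⟨ sumTo-suc n f ⟩
  f 0 ℤ.+ sumTo n (f ∘ suc)                            ≡⟨ cong (λ z → f 0 ℤ.+ z) (sumTo-reverse n (f ∘ suc)) ⟩
  f 0 ℤ.+ sumTo n (λ k → f (suc (n ∸ k)))              ≡⟨ ℤₚ.+-comm (f 0) _ ⟩
  sumTo n (λ k → f (suc (n ∸ k))) ℤ.+ f 0              ≡⟨ cong₂ ℤ._+_
                                                            (sumTo-cong n λ k k≤n → cong f (sym (ℕₚ.+-∸-assoc 1 k≤n)))
                                                            (cong f (sym (ℕₚ.n∸n≡0 n))) ⟩
  sumTo n (λ k → f (suc n ∸ k)) ℤ.+ f (n ∸ n)          ∎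
  where open ≡-Reasoning

-- Coefficient n of a product sees only coefficients up to n; this is what later allows truncated
-- theta sums to stand in for φ.
⊛-cong-≤ : ∀ n {f f′ g g′ : PS} → (∀ k → k ℕ.≤ n → f k ≡ f′ k) → (∀ k → k ℕ.≤ n → g k ≡ g′ k) →
           (f ⊛ g) n ≡ (f′ ⊛ g′) n
⊛-cong-≤ n f≡ g≡ = sumTo-cong n λ k k≤n → cong₂ ℤ._*_ (f≡ k k≤n) (g≡ (n ∸ k) (ℕₚ.m∸n≤m n k))

⊛-cong : ∀ {f f′ g g′ : PS} → f ≗ f′ → g ≗ g′ → f ⊛ g ≗ f′ ⊛ g′
⊛-cong f≡ g≡ n = ⊛-cong-≤ n (λ k _ → f≡ k) (λ k _ → g≡ k)

⊛-suc : ∀ f g n → (f ⊛ g) (suc n) ≡ f 0 ℤ.* g (suc n) ℤ.+ ((f ∘ suc) ⊛ g) n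
⊛-suc f g n = sumTo-suc n (λ k → f k ℤ.* g (suc n ∸ k))

⊛-comm : ∀ f g → f ⊛ g ≗ g ⊛ f
⊛-comm f g n = trans (sumTo-reverse n (λ k → f k ℤ.* g (n ∸ k))) (sumTo-cong n λ k k≤n →
  trans (cong (λ j → f (n ∸ k) ℤ.* g j) (ℕₚ.m∸[m∸n]≡n k≤n)) (ℤₚ.*-comm (f (n ∸ k)) (g k)))

⊛-distribʳ : ∀ h f g → (f ∔ g) ⊛ h ≗ (f ⊛ h) ∔ (g ⊛ h)
⊛-distribʳ h f g n = trans
  (sumTo-cong n λ k _ → ℤₚ.*-distribʳ-+ (h (n ∸ k)) (f k) (g k))
  (sumTo-∔ n _ _)

⊛-distribˡ : ∀ h f g → h ⊛ (f ∔ g) ≗ (h ⊛ f) ∔ (h ⊛ g)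
⊛-distribˡ h f g n = trans
  (sumTo-cong n λ k _ → ℤₚ.*-distribˡ-+ (h k) (f (n ∸ k)) (g (n ∸ k)))
  (sumTo-∔ n _ _)

⊛-scaleˡ : ∀ c f g n → ((λ k → c ℤ.* f k) ⊛ g) n ≡ c ℤ.* (f ⊛ g) n
⊛-scaleˡ c f g n = trans (sumTo-cong n λ k _ → ℤₚ.*-assoc c (f k) _) (sumTo-*ˡ n c _)

-- Peeling off the constant term of the leftmost factor turns degree `suc n` into degree `n` with
-- `f ∘ suc` for `f`, so no double sum has to be reindexed.
⊛-assoc : ∀ f g h → (f ⊛ g) ⊛ h ≗ f ⊛ (g ⊛ h)
⊛-assoc f g h zero    = ℤₚ.*-assoc (f 0) (g 0) (h 0)
⊛-assoc f g h (suc n) = begin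
  ((f ⊛ g) ⊛ h) (suc n)
    ≡⟨ ⊛-suc (f ⊛ g) h n ⟩
  f 0 ℤ.* g 0 ℤ.* h (suc n) ℤ.+ (((f ⊛ g) ∘ suc) ⊛ h) n
    ≡⟨ cong (λ z → f 0 ℤ.* g 0 ℤ.* h (suc n) ℤ.+ z) (begin
       (((f ⊛ g) ∘ suc) ⊛ h) n
         ≡⟨ ⊛-cong {g = h} (⊛-suc f g) (λ _ → refl) n ⟩
       (((λ k → f 0 ℤ.* g (suc k)) ∔ ((f ∘ suc) ⊛ g)) ⊛ h) n
         ≡⟨ ⊛-distribʳ h (λ k → f 0 ℤ.* g (suc k)) ((f ∘ suc) ⊛ g) n ⟩
       ((λ k → f 0 ℤ.* g (suc k)) ⊛ h) n ℤ.+ (((f ∘ suc) ⊛ g) ⊛ h) n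
         ≡⟨ cong₂ ℤ._+_ (⊛-scaleˡ (f 0) (g ∘ suc) h n) (⊛-assoc (f ∘ suc) g h n) ⟩
       f 0 ℤ.* ((g ∘ suc) ⊛ h) n ℤ.+ ((f ∘ suc) ⊛ (g ⊛ h)) n
         ∎) ⟩
  f 0 ℤ.* g 0 ℤ.* h (suc n) ℤ.+ (f 0 ℤ.* ((g ∘ suc) ⊛ h) n ℤ.+ ((f ∘ suc) ⊛ (g ⊛ h)) n)
    ≡⟨ factor (f 0) (g 0) (h (suc n)) _ _ ⟩
  f 0 ℤ.* (g 0 ℤ.* h (suc n) ℤ.+ ((g ∘ suc) ⊛ h) n) ℤ.+ ((f ∘ suc) ⊛ (g ⊛ h)) n
    ≡⟨ cong (λ z → f 0 ℤ.* z ℤ.+ ((f ∘ suc) ⊛ (g ⊛ h)) n) (⊛-suc g h n) ⟨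
  f 0 ℤ.* (g ⊛ h) (suc n) ℤ.+ ((f ∘ suc) ⊛ (g ⊛ h)) n
    ≡⟨ ⊛-suc f (g ⊛ h) n ⟨
  (f ⊛ (g ⊛ h)) (suc n) ∎
  where
  open ≡-Reasoning
  factor : ∀ a b c d e → a ℤ.* b ℤ.* c ℤ.+ (a ℤ.* d ℤ.+ e) ≡ a ℤ.* (b ℤ.* c ℤ.+ d) ℤ.+ e
  factor = solve-∀

const-⊛ : ∀ c f n → (const c ⊛ f) n ≡ c ℤ.* f n
const-⊛ c f zero    = refl
const-⊛ c f (suc n) = trans (⊛-suc (const c) f n)
  (trans (cong (λ z → c ℤ.* f (suc n) ℤ.+ z) (sumTo-zero n λ k _ → refl)) (ℤₚ.+-identityʳ _))

one≗const : one ≗ const 1ℤ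
one≗const zero    = refl
one≗const (suc _) = refl

⊛-identityˡ : ∀ f → one ⊛ f ≗ f
⊛-identityˡ f n =
  trans (⊛-cong {g = f} one≗const (λ _ → refl) n) (trans (const-⊛ 1ℤ f n) (ℤₚ.*-identityˡ (f n)))

X-⊛ : ∀ f → X ⊛ f ≗ shift f
X-⊛ f zero    = refl
X-⊛ f (suc n) = trans (⊛-suc X f n) (trans (ℤₚ.+-identityˡ _) (⊛-identityˡ f n))

-- The ring of power series modulo m

infixl 6 _⊕_
infixl 7 _·_

-- Opaque, because unification would otherwise compare products coefficient by coefficient
-- instead of factor by factor.
opaque
  _⊕_ _·_ : PS → PS → PS
  _⊕_ = _∔_
  _·_ = _⊛_

  ⊖_ : PS → PS
  (⊖ f) n = - f n

  ⊕≗∔ : ∀ f g → f ⊕ g ≗ f ∔ g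
  ⊕≗∔ f g n = refl

  ·≗⊛ : ∀ f g → f · g ≗ f ⊛ g
  ·≗⊛ f g n = refl

  ⊖-coeff : ∀ f n → (⊖ f) n ≡ - f n
  ⊖-coeff f n = refl

-- A record, so that both sides are recoverable from the type by unification.
record _≈[_]_ (f : PS) (m : ℕ) (g : PS) : Set where
  constructor congruent
  field
    coeff : f ≡[mod m ] g

open _≈[_]_ public

infix 4 _≈[_]_

module Congruence (m : ℕ) where

  infix 4 _≈_
  _≈_ : PS → PS → Set
  f ≈ g = f ≈[ m ] g

  private
    fromSigned : ∀ {f g} → (∀ n → (+ m) Signed.∣ (f n ℤ.- g n)) → f ≈ g
    fromSigned h = congruent λ n → Signed.∣⇒∣ᵤ (h n)

    toSigned : ∀ {f g} → f ≈ g → ∀ n → (+ m) Signed.∣ (f n ℤ.- g n)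
    toSigned h n = Signed.∣ᵤ⇒∣ (coeff h n)

  ≗⇒≈ : ∀ {f g} → f ≗ g → f ≈ g
  ≗⇒≈ {f} {g} h = fromSigned λ n → subst ((+ m) Signed.∣_) (sym (ℤₚ.i≡j⇒i-j≡0 (h n))) (Signed.divides 0ℤ refl)

  ≈-refl : ∀ {f} → f ≈ f
  ≈-refl = ≗⇒≈ λ _ → refl

  ≈-sym : ∀ {f g} → f ≈ g → g ≈ f
  ≈-sym {f} {g} h = fromSigned λ n →
    subst ((+ m) Signed.∣_) (negate (f n) (g n)) (Signed.∣m⇒∣-m (toSigned h n))
    where
    negate : ∀ a b → - (a ℤ.- b) ≡ b ℤ.- a
    negate = solve-∀

  ≈-trans : ∀ {f g h} → f ≈ g → g ≈ h → f ≈ h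
  ≈-trans {f} {g} {h} p q = fromSigned λ n →
    subst ((+ m) Signed.∣_) (telescope (f n) (g n) (h n)) (Signed.∣m∣n⇒∣m+n (toSigned p n) (toSigned q n))
    where
    telescope : ∀ a b c → (a ℤ.- b) ℤ.+ (b ℤ.- c) ≡ a ℤ.- c
    telescope = solve-∀

  opaque
    unfolding _⊕_

    ⊕-cong : ∀ {f f′ g g′} → f ≈ f′ → g ≈ g′ → f ⊕ g ≈ f′ ⊕ g′
    ⊕-cong {f} {f′} {g} {g′} p q = fromSigned λ n →
      subst ((+ m) Signed.∣_) (rearrange (f n) (f′ n) (g n) (g′ n)) (Signed.∣m∣n⇒∣m+n (toSigned p n) (toSigned q n))
      where
      rearrange : ∀ a b c d → (a ℤ.- b) ℤ.+ (c ℤ.- d) ≡ (a ℤ.+ c) ℤ.- (b ℤ.+ d)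
      rearrange = solve-∀

    ⊖-cong : ∀ {f g} → f ≈ g → ⊖ f ≈ ⊖ g
    ⊖-cong {f} {g} h = fromSigned λ n →
      subst ((+ m) Signed.∣_) (rearrange (f n) (g n)) (Signed.∣m⇒∣-m (toSigned h n))
      where
      rearrange : ∀ a b → - (a ℤ.- b) ≡ - a ℤ.- - b
      rearrange = solve-∀

    ∣-sumTo-difference : ∀ n (f g : PS) → (∀ k → (+ m) Signed.∣ (f k ℤ.- g k)) → (+ m) Signed.∣ (sumTo n f ℤ.- sumTo n g)
    ∣-sumTo-difference zero    f g h = h 0
    ∣-sumTo-difference (suc n) f g h =
      subst ((+ m) Signed.∣_) (rearrange (sumTo n f) (sumTo n g) (f (suc n)) (g (suc n)))
        (Signed.∣m∣n⇒∣m+n (∣-sumTo-difference n f g h) (h (suc n)))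
      where
      rearrange : ∀ a b c d → (a ℤ.- b) ℤ.+ (c ℤ.- d) ≡ (a ℤ.+ c) ℤ.- (b ℤ.+ d)
      rearrange = solve-∀

    ·-cong : ∀ {f f′ g g′} → f ≈ f′ → g ≈ g′ → f · g ≈ f′ · g′
    ·-cong {f} {f′} {g} {g′} p q = fromSigned λ n → ∣-sumTo-difference n _ _ λ k →
      subst ((+ m) Signed.∣_) (rearrange (f k) (f′ k) (g (n ∸ k)) (g′ (n ∸ k)))
        (Signed.∣m∣n⇒∣m+n (Signed.∣n⇒∣m*n (g (n ∸ k)) (toSigned p k)) (Signed.∣n⇒∣m*n (f′ k) (toSigned q (n ∸ k))))
      where
      rearrange : ∀ a b c d → c ℤ.* (a ℤ.- b) ℤ.+ b ℤ.* (c ℤ.- d) ≡ a ℤ.* c ℤ.- b ℤ.* d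
      rearrange = solve-∀

    isCommutativeRing : IsCommutativeRing _≈_ _⊕_ _·_ ⊖_ (const 0ℤ) one
    isCommutativeRing = record
      { isRing = record
        { +-isAbelianGroup = record
          { isGroup = record
            { isMonoid = record
              { isSemigroup = record
                { isMagma = record
                  { isEquivalence = record
                    { refl  = ≈-refl
                    ; sym   = ≈-sym
                    ; trans = ≈-trans
                    }
                  ; ∙-cong = ⊕-cong
                  }
                ; assoc = λ f g h → ≗⇒≈ λ n → ℤₚ.+-assoc (f n) (g n) (h n)
                }
              ; identity = (λ f → ≗⇒≈ λ { zero → ℤₚ.+-identityˡ (f 0) ; (suc n) → ℤₚ.+-identityˡ (f (suc n)) })
                         , (λ f → ≗⇒≈ λ { zero → ℤₚ.+-identityʳ (f 0) ; (suc n) → ℤₚ.+-identityʳ (f (suc n)) })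
              }
            ; inverse = (λ f → ≗⇒≈ λ { zero → ℤₚ.+-inverseˡ (f 0) ; (suc n) → ℤₚ.+-inverseˡ (f (suc n)) })
                      , (λ f → ≗⇒≈ λ { zero → ℤₚ.+-inverseʳ (f 0) ; (suc n) → ℤₚ.+-inverseʳ (f (suc n)) })
            ; ⁻¹-cong = ⊖-cong
            }
          ; comm = λ f g → ≗⇒≈ λ n → ℤₚ.+-comm (f n) (g n)
          }
        ; *-cong = ·-cong
        ; *-assoc = λ f g h → ≗⇒≈ (⊛-assoc f g h)
        ; *-identity = (λ f → ≗⇒≈ (⊛-identityˡ f)) , (λ f → ≗⇒≈ λ n → trans (⊛-comm f one n) (⊛-identityˡ f n))
        ; distrib = (λ h f g → ≗⇒≈ (⊛-distribˡ h f g)) , (λ h f g → ≗⇒≈ (⊛-distribʳ h f g))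
        }
      ; *-comm = λ f g → ≗⇒≈ (⊛-comm f g)
      }

  powerSeriesRing : CommutativeRing 0ℓ 0ℓ
  powerSeriesRing = record
    { Carrier = PS
    ; _≈_ = _≈_
    ; _+_ = _⊕_
    ; _*_ = _·_
    ; -_ = ⊖_
    ; 0# = const 0ℤ
    ; 1# = one
    ; isCommutativeRing = isCommutativeRing
    }

  open CommutativeRing powerSeriesRing public
    using (+-cong; *-cong; *-comm; +-assoc; +-identityˡ; +-identityʳ
          ; *-identityˡ; *-identityʳ; *-assoc; distribˡ; distribʳ; zeroˡ; zeroʳ)

  module ≈-Reasoning = SetoidReasoning (CommutativeRing.setoid powerSeriesRing)

  const-multiple≈0 : ∀ f → const (+ m) · f ≈ const 0ℤ
  const-multiple≈0 f = fromSigned λ n →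
    subst (λ z → (+ m) Signed.∣ (z ℤ.- const 0ℤ n)) (sym (trans (·≗⊛ (const (+ m)) f n) (const-⊛ (+ m) f n)))
      (Signed.∣m∣n⇒∣m-n (Signed.∣m⇒∣m*n (f n) Signed.∣-refl)
         (subst ((+ m) Signed.∣_) (sym (const-0 n)) (Signed.divides 0ℤ refl)))

  private
    -- With ℤ as coefficient ring, the solver can compare constants decidably, and numerals such as
    -- 8 and 9 may occur in the identities it proves.
    constants : CommutativeRing.rawRing ℤₚ.+-*-commutativeRing
                  -Raw-AlmostCommutative⟶ fromCommutativeRing powerSeriesRing
    constants = record
      { ⟦_⟧    = const
      ; +-homo = λ c d → ≗⇒≈ λ n → trans (const-+ c d n) (sym (⊕≗∔ (const c) (const d) n))
      ; *-homo = λ c d → ≗⇒≈ λ n → trans (const-* c d n) (sym (trans (·≗⊛ (const c) (const d) n) (const-⊛ c (const d) n)))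
      ; -‿homo = λ c → ≗⇒≈ λ n → trans (const-- c n) (sym (⊖-coeff (const c) n))
      ; 0-homo = ≗⇒≈ λ _ → refl
      ; 1-homo = ≗⇒≈ λ n → sym (one≗const n)
      }
      where
      const-+ : ∀ c d → const (c ℤ.+ d) ≗ const c ∔ const d
      const-+ c d zero    = refl
      const-+ c d (suc _) = refl
      const-- : ∀ c n → const (- c) n ≡ - const c n
      const-- c zero    = refl
      const-- c (suc _) = refl
      const-* : ∀ c d n → const (c ℤ.* d) n ≡ c ℤ.* const d n
      const-* c d zero    = refl
      const-* c d (suc n) = sym (ℤₚ.*-zeroʳ c)

    equal-constants : ∀ c d → Maybe (const c ≈ const d)
    equal-constants c d with c ℤ.≟ d
    ... | yes refl = just ≈-refl
    ... | no _     = nothing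

  module Solver where
    open import Algebra.Solver.Ring
      (CommutativeRing.rawRing ℤₚ.+-*-commutativeRing) (fromCommutativeRing powerSeriesRing)
      constants equal-constants public

-- Divisibility by 0 is equality. Exact identities are therefore proved as congruences modulo 0,
-- with the same ring structure and solver as the others.
≈0⇒≗ : ∀ {f g} → f ≈[ 0 ] g → f ≗ g
≈0⇒≗ {f} {g} h n = ℤₚ.i-j≡0⇒i≡j (f n) (g n) (Signed.0∣⇒≡0 (Signed.∣ᵤ⇒∣ (coeff h n)))

-- Multiplicative inverses

mutual
  -- `inv` is computed by private functions of Defs. Abstracting the shifted series in the second
  -- unfolding of `inv` lets unification name the convolution of one series with the inverse of another.
  convolveInv : PS → PS → ℕ → ℤ
  convolveInv = _

  inv-unfold₂ : ∀ f n → inv f (2 ℕ.+ n) ≡ - (f 1 ℤ.* inv f (suc n) ℤ.+ convolveInv (λ k → f (suc k)) f n)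
  inv-unfold₂ f n with (λ (k : ℕ) → f (suc k))
  ... | w = refl

-- The stored coefficients of the inverse run from the highest degree down, so pairing them with
-- `g 1`, `g 2`, ... is already a Cauchy product; each entry consumed shifts `g` by one.
convolveInv≡⊛ : ∀ g f n → convolveInv g f n ≡ ((g ∘ suc) ⊛ inv f) n
convolveInv≡⊛ g f zero    = ℤₚ.+-identityʳ _
convolveInv≡⊛ g f (suc n) =
  trans (cong (λ z → g 1 ℤ.* inv f (suc n) ℤ.+ z) (convolveInv≡⊛ (g ∘ suc) f n))
        (sym (⊛-suc (g ∘ suc) (inv f) n))

-- Each new coefficient of `inv f` is minus the rest of the Cauchy sum, which cancels it exactly
-- when the constant term is 1.
⊛-inv : ∀ f → f 0 ≡ 1ℤ → f ⊛ inv f ≗ one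
⊛-inv f f0≡1 zero    = cong (λ c → c ℤ.* 1ℤ) f0≡1
⊛-inv f f0≡1 (suc n) = begin
  (f ⊛ inv f) (suc n)                                        ≡⟨ ⊛-suc f (inv f) n ⟩
  f 0 ℤ.* inv f (suc n) ℤ.+ ((f ∘ suc) ⊛ inv f) n            ≡⟨ cong₂ ℤ._+_
                                                                  (cong (λ c → c ℤ.* inv f (suc n)) f0≡1)
                                                                  (sym (convolveInv≡⊛ f f n)) ⟩
  1ℤ ℤ.* - convolveInv f f n ℤ.+ convolveInv f f n           ≡⟨ cong (λ z → z ℤ.+ convolveInv f f n) (ℤₚ.*-identityˡ (- convolveInv f f n)) ⟩
  - convolveInv f f n ℤ.+ convolveInv f f n                  ≡⟨ ℤₚ.+-inverseˡ (convolveInv f f n) ⟩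
  0ℤ                                                         ∎
  where open ≡-Reasoning

-- The substitution of -q for q

sgn-+ : ∀ m n → sgn (m ℕ.+ n) ≡ sgn m ℤ.* sgn n
sgn-+ zero    n = sym (ℤₚ.*-identityˡ (sgn n))
sgn-+ (suc m) n = trans (cong -_ (sgn-+ m n)) (ℤₚ.neg-distribˡ-* (sgn m) (sgn n))

-- Since 3 is odd, replacing q by -q commutes with passing from n to 3n; hence the signs in the
-- theorem can be absorbed before U is applied.
sgn-*3 : ∀ n → sgn (n ℕ.* 3) ≡ sgn n
sgn-*3 zero    = refl
sgn-*3 (suc n) = trans (ℤₚ.neg-involutive _) (cong -_ (sgn-*3 n))

subNeg-⊛ : ∀ f g → subNeg f ⊛ subNeg g ≗ subNeg (f ⊛ g)
subNeg-⊛ f g n = trans (sumTo-cong n term) (sumTo-*ˡ n (sgn n) _)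
  where
  rearrange : ∀ s a t b → (s ℤ.* a) ℤ.* (t ℤ.* b) ≡ (s ℤ.* t) ℤ.* (a ℤ.* b)
  rearrange = solve-∀
  term : ∀ k → k ℕ.≤ n → subNeg f k ℤ.* subNeg g (n ∸ k) ≡ sgn n ℤ.* (f k ℤ.* g (n ∸ k))
  term k k≤n = trans (rearrange (sgn k) (f k) (sgn (n ∸ k)) (g (n ∸ k)))
    (cong (λ s → s ℤ.* (f k ℤ.* g (n ∸ k)))
      (trans (sym (sgn-+ k (n ∸ k))) (cong sgn (ℕₚ.m+[n∸m]≡n k≤n))))

subNeg-one : subNeg one ≗ one
subNeg-one zero    = refl
subNeg-one (suc n) = ℤₚ.*-zeroʳ (sgn (suc n))

subNeg-^^ : ∀ f k → subNeg f ^^ k ≗ subNeg (f ^^ k)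
subNeg-^^ f zero    n = sym (subNeg-one n)
subNeg-^^ f (suc k) n = trans (⊛-cong {subNeg f} (λ _ → refl) (subNeg-^^ f k) n) (subNeg-⊛ f (f ^^ k) n)

subNeg-involutive : ∀ f → subNeg (subNeg f) ≗ f
subNeg-involutive f n = trans (sym (ℤₚ.*-assoc (sgn n) (sgn n) (f n)))
  (trans (cong (ℤ._* f n) (sgn² n)) (ℤₚ.*-identityˡ (f n)))
  where
  neg² : ∀ s → - s ℤ.* - s ≡ s ℤ.* s
  neg² = solve-∀
  sgn² : ∀ n → sgn n ℤ.* sgn n ≡ 1ℤ
  sgn² zero    = refl
  sgn² (suc n) = trans (neg² (sgn n)) (sgn² n)

-- Replacing q by -q is multiplicative and involutive; applied to φ(-q)³ times the generating
-- function, it leaves φ(q)³ as one factor.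
φ³⊛pbar3 : (φ ^^ 3) ⊛ subNeg pbar3 ≗ one
φ³⊛pbar3 n = begin
  ((φ ^^ 3) ⊛ subNeg pbar3) n                     ≡⟨ ⊛-cong {g = subNeg pbar3} (subNeg-involutive (φ ^^ 3)) (λ _ → refl) n ⟨
  (subNeg (subNeg (φ ^^ 3)) ⊛ subNeg pbar3) n     ≡⟨ subNeg-⊛ (subNeg (φ ^^ 3)) pbar3 n ⟩
  sgn n ℤ.* (subNeg (φ ^^ 3) ⊛ pbar3) n           ≡⟨ cong (sgn n ℤ.*_) (⊛-cong {g = pbar3} (subNeg-^^ φ 3) (λ _ → refl) n) ⟨
  sgn n ℤ.* ((subNeg φ ^^ 3) ⊛ pbar3) n           ≡⟨ cong (sgn n ℤ.*_) (⊛-inv (subNeg φ ^^ 3) refl n) ⟩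
  subNeg one n                                    ≡⟨ subNeg-one n ⟩
  one n                                           ∎
  where open ≡-Reasoning

-- Dissection modulo 3

-- Recursion in steps of three fits the form `i + k * 3`, in which the factor 3 stands on the right
-- so that `suc k * 3` reduces to `3 + k * 3`.
residue-cases : (P : ℕ → Set) → (∀ k → P (k ℕ.* 3)) → (∀ k → P (1 ℕ.+ k ℕ.* 3)) → (∀ k → P (2 ℕ.+ k ℕ.* 3)) → ∀ n → P n
residue-cases P p₀ p₁ p₂ 0 = p₀ 0
residue-cases P p₀ p₁ p₂ 1 = p₁ 0
residue-cases P p₀ p₁ p₂ 2 = p₂ 0
residue-cases P p₀ p₁ p₂ (suc (suc (suc n))) =
  residue-cases (λ k → P (3 ℕ.+ k)) (λ k → p₀ (suc k)) (λ k → p₁ (suc k)) (λ k → p₂ (suc k)) n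

-- `section 0` is the operator U. The classes 1 and 2 enter because multiplication by q carries each
-- class to the next.
section : ℕ → PS → PS
section i f n = f (i ℕ.+ n ℕ.* 3)

sub3-0 : ∀ f n → sub3 f (n ℕ.* 3) ≡ f n
sub3-0 f n rewrite DivMod.m*n%n≡0 n 3 {{_}} = cong f (DivMod.m*n/n≡m n 3)

sub3-1 : ∀ f n → sub3 f (1 ℕ.+ n ℕ.* 3) ≡ 0ℤ
sub3-1 f n rewrite DivMod.[m+kn]%n≡m%n 1 n 3 {{_}} = refl

sub3-2 : ∀ f n → sub3 f (2 ℕ.+ n ℕ.* 3) ≡ 0ℤ
sub3-2 f n rewrite DivMod.[m+kn]%n≡m%n 2 n 3 {{_}} = refl

add-zero : ∀ {a b c} → a ≡ b → c ≡ 0ℤ → a ℤ.+ c ≡ b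
add-zero {b = b} refl refl = ℤₚ.+-identityʳ b

sumTo-multiples : ∀ n {f : PS} → (∀ k → f (1 ℕ.+ k ℕ.* 3) ≡ 0ℤ) → (∀ k → f (2 ℕ.+ k ℕ.* 3) ≡ 0ℤ) →
                  sumTo (n ℕ.* 3) f ≡ sumTo n (λ k → f (k ℕ.* 3))
sumTo-multiples zero    f₁≡0 f₂≡0 = refl
sumTo-multiples (suc n) {f} f₁≡0 f₂≡0 = cong (ℤ._+ f (3 ℕ.+ n ℕ.* 3))
  (add-zero (add-zero (sumTo-multiples n f₁≡0 f₂≡0) (f₁≡0 n)) (f₂≡0 n))

module _ (f g : PS) (n : ℕ) where

  private
    -- The sum stops at `n * 3`: for i = 1, 2 the one or two terms beyond it meet `sub3 f` at
    -- non-multiples of 3, and are removed by the lemmas that follow.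
    collapse : ∀ i → sumTo (n ℕ.* 3) (λ k → sub3 f k ℤ.* g (i ℕ.+ n ℕ.* 3 ∸ k)) ≡ (f ⊛ section i g) n
    collapse i = trans
      (sumTo-multiples n
        (λ k → cong (λ z → z ℤ.* g (i ℕ.+ n ℕ.* 3 ∸ (1 ℕ.+ k ℕ.* 3))) (sub3-1 f k))
        (λ k → cong (λ z → z ℤ.* g (i ℕ.+ n ℕ.* 3 ∸ (2 ℕ.+ k ℕ.* 3))) (sub3-2 f k)))
      (sumTo-cong n λ k k≤n → cong₂ ℤ._*_ (sub3-0 f k) (cong g (trans
        (ℕₚ.+-∸-assoc i (ℕₚ.*-monoˡ-≤ 3 k≤n)) (cong (i ℕ.+_) (sym (ℕₚ.*-distribʳ-∸ 3 n k))))))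

  section₀-sub3-⊛ : section 0 (sub3 f ⊛ g) n ≡ (f ⊛ section 0 g) n
  section₀-sub3-⊛ = collapse 0

  section₁-sub3-⊛ : section 1 (sub3 f ⊛ g) n ≡ (f ⊛ section 1 g) n
  section₁-sub3-⊛ = add-zero (collapse 1) (cong (λ z → z ℤ.* g (n ℕ.* 3 ∸ n ℕ.* 3)) (sub3-1 f n))

  section₂-sub3-⊛ : section 2 (sub3 f ⊛ g) n ≡ (f ⊛ section 2 g) n
  section₂-sub3-⊛ = add-zero
    (add-zero (collapse 2) (cong (λ z → z ℤ.* g (1 ℕ.+ n ℕ.* 3 ∸ n ℕ.* 3)) (sub3-1 f n)))
    (cong (λ z → z ℤ.* g (n ℕ.* 3 ∸ n ℕ.* 3)) (sub3-2 f n))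

-- This is where the carry happens: class 2 wraps around to class 0 of the next block of three,
-- which costs a factor q.
section₀-X : ∀ f → section 0 (X ⊛ f) ≗ X ⊛ section 2 f
section₀-X f zero    = refl
section₀-X f (suc n) = trans (X-⊛ f (3 ℕ.+ n ℕ.* 3)) (sym (X-⊛ (section 2 f) (suc n)))

section₁-X : ∀ f → section 1 (X ⊛ f) ≗ section 0 f
section₁-X f n = X-⊛ f (1 ℕ.+ n ℕ.* 3)

section₂-X : ∀ f → section 2 (X ⊛ f) ≗ section 1 f
section₂-X f n = X-⊛ f (2 ℕ.+ n ℕ.* 3)

sub3-⊛ : ∀ f g → sub3 f ⊛ sub3 g ≗ sub3 (f ⊛ g)
sub3-⊛ f g = residue-cases _
  (λ n → trans (section₀-sub3-⊛ f (sub3 g) n)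
    (trans (⊛-cong {f} (λ _ → refl) (sub3-0 g) n) (sym (sub3-0 (f ⊛ g) n))))
  (λ n → trans (section₁-sub3-⊛ f (sub3 g) n) (trans (vanishes (sub3-1 g) n) (sym (sub3-1 (f ⊛ g) n))))
  (λ n → trans (section₂-sub3-⊛ f (sub3 g) n) (trans (vanishes (sub3-2 g) n) (sym (sub3-2 (f ⊛ g) n))))
  where
  vanishes : ∀ {h} → (∀ n → h n ≡ 0ℤ) → ∀ n → (f ⊛ h) n ≡ 0ℤ
  vanishes h≡0 n = sumTo-zero n λ k _ → trans (cong (λ z → f k ℤ.* z) (h≡0 (n ∸ k))) (ℤₚ.*-zeroʳ (f k))

sub3-one : sub3 one ≗ one
sub3-one = residue-cases _
  (λ { zero → refl ; (suc n) → sub3-0 one (suc n) }) (sub3-1 one) (sub3-2 one)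

sub3-cong : ∀ {f g} → f ≗ g → sub3 f ≗ sub3 g
sub3-cong {f} {g} f≗g = residue-cases _
  (λ n → trans (sub3-0 f n) (trans (f≗g n) (sym (sub3-0 g n))))
  (λ n → trans (sub3-1 f n) (sym (sub3-1 g n)))
  (λ n → trans (sub3-2 f n) (sym (sub3-2 g n)))

-- The theta function φ and its dissection

φ-term : ℕ → ℕ → ℤ
φ-term n j = if does (j ℕ.* j ≟ n) then (if does (j ≟ 0) then + 1 else + 2) else + 0

φ-term-0 : ∀ {n j} → j ℕ.* j ≢ n → φ-term n j ≡ 0ℤ
φ-term-0 {n} {j} j²≢n rewrite dec-false (j ℕ.* j ≟ n) j²≢n = refl

n≤n² : ∀ n → n ℕ.≤ n ℕ.* n
n≤n² zero    = z≤n
n≤n² (suc n) = ℕₚ.m≤m*n (suc n) (suc n)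

sumTo-extend : ∀ d n {f : PS} → (∀ k → n ℕ.< k → f k ≡ 0ℤ) → sumTo (d ℕ.+ n) f ≡ sumTo n f
sumTo-extend zero    n f≡0 = refl
sumTo-extend (suc d) n {f} f≡0 = trans
  (cong₂ ℤ._+_ (sumTo-extend d n f≡0) (f≡0 (suc d ℕ.+ n) (s≤s (ℕₚ.m≤n+m n d)))) (ℤₚ.+-identityʳ _)

square-%3 : ∀ j → (j ℕ.* j) % 3 ≡ ((j % 3) ℕ.* (j % 3)) % 3
square-%3 j = DivMod.%-distribˡ-* j j 3

square≢2+3k : ∀ j k → j ℕ.* j ≢ 2 ℕ.+ k ℕ.* 3
square≢2+3k j k j²≡ = no-root (j % 3) (DivMod.m%n<n j 3)
  (trans (sym (square-%3 j)) (trans (cong (_% 3) j²≡) (DivMod.[m+kn]%n≡m%n 2 k 3)))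
  where
  no-root : ∀ r → r ℕ.< 3 → (r ℕ.* r) % 3 ≢ 2
  no-root 0 _ ()
  no-root 1 _ ()
  no-root 2 _ ()
  no-root (suc (suc (suc _))) (s≤s (s≤s (s≤s ())))

square-unit≢3k : ∀ i j k → i ℕ.* i % 3 ≡ 1 → i % 3 ≡ i → (i ℕ.+ j ℕ.* 3) ℕ.* (i ℕ.+ j ℕ.* 3) ≢ k ℕ.* 3
square-unit≢3k i j k i²≡1 i%3 eq = ℕₚ.1+n≢0 (trans (sym (begin
  (i ℕ.+ j ℕ.* 3) ℕ.* (i ℕ.+ j ℕ.* 3) % 3                  ≡⟨ square-%3 (i ℕ.+ j ℕ.* 3) ⟩
  ((i ℕ.+ j ℕ.* 3) % 3) ℕ.* ((i ℕ.+ j ℕ.* 3) % 3) % 3      ≡⟨ cong (λ r → r ℕ.* r % 3) (trans (DivMod.[m+kn]%n≡m%n i j 3) i%3) ⟩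
  i ℕ.* i % 3                                              ≡⟨ i²≡1 ⟩
  1                                                        ∎)) (trans (cong (_% 3) eq) (DivMod.m*n%n≡0 k 3)))
  where open ≡-Reasoning

-- An index j > n has j² > n, so summing beyond the range used in `φ n` adds only zeros.
φ-truncate : ∀ {n N} → n ℕ.≤ N → sumTo N (φ-term n) ≡ φ n
φ-truncate {n} {N} n≤N = trans (cong (λ m → sumTo m (φ-term n)) (sym (ℕₚ.m∸n+n≡m n≤N)))
  (sumTo-extend (N ∸ n) n λ j n<j → φ-term-0 {j = j} λ j²≡n → ℕₚ.<⇒≱ n<j (subst (j ℕ.≤_) j²≡n (n≤n² j)))

φ-2+3n : ∀ n → φ (2 ℕ.+ n ℕ.* 3) ≡ 0ℤ
φ-2+3n n = sumTo-zero (2 ℕ.+ n ℕ.* 3) λ j _ → φ-term-0 {j = j} (square≢2+3k j n)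

-- A number whose square is 3n must be a multiple 3j of 3, and then n = 3j². Thus n is itself a
-- multiple of 3, and the roots of 3n correspond to those of n / 3.
φ-3n : ∀ n → φ (n ℕ.* 3) ≡ sub3 φ n
φ-3n n = trans
  (sumTo-multiples n
    (λ j → φ-term-0 {j = 1 ℕ.+ j ℕ.* 3} (square-unit≢3k 1 j n refl refl))
    (λ j → φ-term-0 {j = 2 ℕ.+ j ℕ.* 3} (square-unit≢3k 2 j n refl refl)))
  (residue-cases (λ n → sumTo n (λ j → φ-term (n ℕ.* 3) (j ℕ.* 3)) ≡ sub3 φ n)
    (λ m → trans (trans (sumTo-cong (m ℕ.* 3) λ j _ → rescale m j) (φ-truncate (ℕₚ.m≤m*n m 3))) (sym (sub3-0 φ m)))
    (λ m → trans (no-square 1 m (λ ())) (sym (sub3-1 φ m)))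
    (λ m → trans (no-square 2 m (λ ())) (sym (sub3-2 φ m)))
    n)
  where
  nine : ∀ j → (j ℕ.* 3) ℕ.* (j ℕ.* 3) ≡ j ℕ.* j ℕ.* 3 ℕ.* 3
  nine = ℕ-solve-∀
  rescale : ∀ m j → φ-term (m ℕ.* 3 ℕ.* 3) (j ℕ.* 3) ≡ φ-term m j
  rescale m j = cong₂ (λ b c → if b then (if c then + 1 else + 2) else + 0)
    (does-⇔
      (mk⇔ (λ eq → ℕₚ.*-cancelʳ-≡ _ _ 3 (ℕₚ.*-cancelʳ-≡ _ _ 3 (trans (sym (nine j)) eq)))
           (λ eq → trans (nine j) (cong (λ z → z ℕ.* 3 ℕ.* 3) eq)))
      ((j ℕ.* 3) ℕ.* (j ℕ.* 3) ≟ m ℕ.* 3 ℕ.* 3) (j ℕ.* j ≟ m))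
    (does-⇔ (mk⇔ (ℕₚ.*-cancelʳ-≡ j 0 3) (cong (ℕ._* 3))) (j ℕ.* 3 ≟ 0) (j ≟ 0))
  no-square : ∀ i m → ¬ (i % 3 ≡ 0) →
    sumTo (i ℕ.+ m ℕ.* 3) (λ j → φ-term ((i ℕ.+ m ℕ.* 3) ℕ.* 3) (j ℕ.* 3)) ≡ 0ℤ
  no-square i m i≢0 = sumTo-zero (i ℕ.+ m ℕ.* 3) λ j _ → φ-term-0 {j = j ℕ.* 3} λ eq →
    i≢0 (trans (sym (DivMod.[m+kn]%n≡m%n i m 3))
      (trans (cong (_% 3) (sym (ℕₚ.*-cancelʳ-≡ (j ℕ.* j ℕ.* 3) (i ℕ.+ m ℕ.* 3) 3 (trans (sym (nine j)) eq)))) (DivMod.m*n%n≡0 (j ℕ.* j) 3)))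

-- Explicitly 2 Σ q^(3k² + 2k) over all integers k, from the squares (3k ± 1)².
β : PS
β = section 1 φ

X-sub3-0 : ∀ f n → (X ⊛ sub3 f) (n ℕ.* 3) ≡ 0ℤ
X-sub3-0 f zero    = refl
X-sub3-0 f (suc n) = trans (X-⊛ (sub3 f) (suc n ℕ.* 3)) (sub3-2 f n)

X-sub3-1 : ∀ f n → (X ⊛ sub3 f) (1 ℕ.+ n ℕ.* 3) ≡ f n
X-sub3-1 f n = trans (X-⊛ (sub3 f) (1 ℕ.+ n ℕ.* 3)) (sub3-0 f n)

X-sub3-2 : ∀ f n → (X ⊛ sub3 f) (2 ℕ.+ n ℕ.* 3) ≡ 0ℤ
X-sub3-2 f n = trans (X-⊛ (sub3 f) (2 ℕ.+ n ℕ.* 3)) (sub3-1 f n)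

φ-3-dissection : φ ≗ sub3 (sub3 φ) ∔ (X ⊛ sub3 β)
φ-3-dissection = residue-cases _
  (λ n → sym (add-zero (trans (sub3-0 (sub3 φ) n) (sym (φ-3n n))) (X-sub3-0 β n)))
  (λ n → sym (trans (cong₂ ℤ._+_ (sub3-1 (sub3 φ) n) (X-sub3-1 β n)) (ℤₚ.+-identityˡ _)))
  (λ n → trans (φ-2+3n n) (sym (cong₂ ℤ._+_ (sub3-2 (sub3 φ) n) (X-sub3-2 β n))))

-- Vectors of ℤ⁴ over the tetracode

-- Opposite integers are adjacent in this order. Reflection then swaps neighbours, and each pair
-- matches one term with coefficient 2 in φ.
interval : ℕ → List ℤ
interval zero    = 0ℤ ∷ []
interval (suc m) = + suc m ∷ -[1+ m ] ∷ interval m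

∈-interval⁻ : ∀ m {x} → x ∈ interval m → ∣ x ∣ ℕ.≤ m
∈-interval⁻ zero    (here refl)         = z≤n
∈-interval⁻ (suc m) (here refl)         = ℕₚ.≤-refl
∈-interval⁻ (suc m) (there (here refl)) = ℕₚ.≤-refl
∈-interval⁻ (suc m) (there (there x∈))  = ℕₚ.m≤n⇒m≤1+n (∈-interval⁻ m x∈)

∈-interval⁺ : ∀ m {x} → ∣ x ∣ ℕ.≤ m → x ∈ interval m
∈-interval⁺ zero    {+ zero} _ = here refl
∈-interval⁺ (suc m) {x} x≤ with ℕₚ.m≤n⇒m<n∨m≡n x≤
∈-interval⁺ (suc m) {x}         x≤ | inj₁ (s≤s x≤m) = there (there (∈-interval⁺ m x≤m))
∈-interval⁺ (suc m) {+ _}       x≤ | inj₂ refl      = here refl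
∈-interval⁺ (suc m) { -[1+ _ ]} x≤ | inj₂ refl      = there (here refl)

interval-unique : ∀ m → Unique (interval m)
interval-unique zero    = [] ∷ []
interval-unique (suc m) =
  ((λ ()) ∷ outside λ { refl → refl }) ∷ outside (λ { refl → refl }) ∷ interval-unique m
  where
  outside : ∀ {x} → (∀ {y} → x ≡ y → ∣ y ∣ ≡ suc m) → All (λ y → x ≢ y) (interval m)
  outside far = All.tabulate λ y∈ x≡y → ℕₚ.<⇒≱ (ℕₚ.≤-reflexive (sym (far x≡y))) (∈-interval⁻ m y∈)

ℤ⁴ : Set
ℤ⁴ = ℤ × ℤ × ℤ × ℤ

box : ℕ → List ℤ⁴
box m = cartesianProduct I (cartesianProduct I (cartesianProduct I I))
  where I = interval m

box-unique : ∀ m → Unique (box m)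
box-unique m = Unique.cartesianProduct⁺ u (Unique.cartesianProduct⁺ u (Unique.cartesianProduct⁺ u u))
  where u = interval-unique m

square : ℤ → ℕ
square x = ∣ x ∣ ℕ.* ∣ x ∣

norm : ℤ⁴ → ℕ
norm (x , y , z , w) = square x ℕ.+ (square y ℕ.+ (square z ℕ.+ square w))

+square : ∀ x → + square x ≡ x ℤ.* x
+square (+ n)    = ℤₚ.pos-* n n
+square -[1+ n ] = refl

+norm : ∀ x y z w → + norm (x , y , z , w) ≡ x ℤ.* x ℤ.+ (y ℤ.* y ℤ.+ (z ℤ.* z ℤ.+ w ℤ.* w))
+norm x y z w = cong₂ ℤ._+_ (+square x) (cong₂ ℤ._+_ (+square y) (cong₂ ℤ._+_ (+square z) (+square w)))

-- Every coordinate satisfies ∣x∣ ≤ x² ≤ norm, so the crude half-width m suffices.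
∈-box : ∀ m v → norm v ℕ.≤ m → v ∈ box m
∈-box m (x , y , z , w) n≤m = ∈-cartesianProduct⁺ (coordinate x X≤)
  (∈-cartesianProduct⁺ (coordinate y Y≤) (∈-cartesianProduct⁺ (coordinate z Z≤) (coordinate w W≤)))
  where
  coordinate : ∀ x → square x ℕ.≤ m → x ∈ interval m
  coordinate x x²≤m = ∈-interval⁺ m (ℕₚ.≤-trans (n≤n² ∣ x ∣) x²≤m)
  X≤ = ℕₚ.m+n≤o⇒m≤o (square x) n≤m
  rest₁ = ℕₚ.m+n≤o⇒n≤o (square x) n≤m
  Y≤ = ℕₚ.m+n≤o⇒m≤o (square y) rest₁
  rest₂ = ℕₚ.m+n≤o⇒n≤o (square y) rest₁
  Z≤ = ℕₚ.m+n≤o⇒m≤o (square z) rest₂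
  W≤ = ℕₚ.m+n≤o⇒n≤o (square z) rest₂

-- The matrix C has zero diagonal and entries ±1 elsewhere, is skew-symmetric and satisfies C Cᵀ = 3
-- I. Its inverse is therefore Cᵀ / 3.
conference : ℤ⁴ → ℤ⁴
conference (x , y , z , w) =
  y ℤ.+ z ℤ.+ w , z ℤ.- x ℤ.- w , w ℤ.- x ℤ.- y , y ℤ.- x ℤ.- z

conference-norm : ∀ v → norm (conference v) ≡ norm v ℕ.* 3
conference-norm (x , y , z , w) = ℤₚ.+-injective (begin
  + norm (conference (x , y , z , w))  ≡⟨ +norm (y ℤ.+ z ℤ.+ w) (z ℤ.- x ℤ.- w) (w ℤ.- x ℤ.- y) (y ℤ.- x ℤ.- z) ⟩
  _                                    ≡⟨ orthogonality x y z w ⟩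
  (x ℤ.* x ℤ.+ (y ℤ.* y ℤ.+ (z ℤ.* z ℤ.+ w ℤ.* w))) ℤ.* + 3
                                       ≡⟨ cong (ℤ._* + 3) (+norm x y z w) ⟨
  + norm (x , y , z , w) ℤ.* + 3       ≡⟨ ℤₚ.pos-* (norm (x , y , z , w)) 3 ⟨
  + (norm (x , y , z , w) ℕ.* 3)       ∎)
  where
  open ≡-Reasoning
  orthogonality : ∀ x y z w →
    (y ℤ.+ z ℤ.+ w) ℤ.* (y ℤ.+ z ℤ.+ w) ℤ.+
      ((z ℤ.- x ℤ.- w) ℤ.* (z ℤ.- x ℤ.- w) ℤ.+
        ((w ℤ.- x ℤ.- y) ℤ.* (w ℤ.- x ℤ.- y) ℤ.+ (y ℤ.- x ℤ.- z) ℤ.* (y ℤ.- x ℤ.- z)))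
    ≡ (x ℤ.* x ℤ.+ (y ℤ.* y ℤ.+ (z ℤ.* z ℤ.+ w ℤ.* w))) ℤ.* + 3
  orthogonality = solve-∀

-- Applying Cᵀ recovers 3v; the four functionals below are the columns of C.
conference-injective : ∀ {v v′} → conference v ≡ conference v′ → v ≡ v′
conference-injective {x , y , z , w} {x′ , y′ , z′ , w′} eq =
  cong₂ _,_ (solveFor (λ (a , b , c , d) → - (b ℤ.+ c ℤ.+ d)) (x-from x y z w) (x-from x′ y′ z′ w′))
  (cong₂ _,_ (solveFor (λ (a , b , c , d) → a ℤ.- c ℤ.+ d) (y-from x y z w) (y-from x′ y′ z′ w′))
  (cong₂ _,_ (solveFor (λ (a , b , c , d) → a ℤ.+ b ℤ.- d) (z-from x y z w) (z-from x′ y′ z′ w′))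
             (solveFor (λ (a , b , c , d) → a ℤ.- b ℤ.+ c) (w-from x y z w) (w-from x′ y′ z′ w′))))
  where
  solveFor : ∀ {t t′} (f : ℤ⁴ → ℤ) → f (conference (x , y , z , w)) ≡ t ℤ.* + 3 →
             f (conference (x′ , y′ , z′ , w′)) ≡ t′ ℤ.* + 3 → t ≡ t′
  solveFor {t} {t′} f p q = ℤₚ.*-cancelʳ-≡ t t′ (+ 3) (trans (sym p) (trans (cong f eq) q))
  x-from : ∀ x y z w → - ((z ℤ.- x ℤ.- w) ℤ.+ (w ℤ.- x ℤ.- y) ℤ.+ (y ℤ.- x ℤ.- z)) ≡ x ℤ.* + 3
  x-from = solve-∀
  y-from : ∀ x y z w → (y ℤ.+ z ℤ.+ w) ℤ.- (w ℤ.- x ℤ.- y) ℤ.+ (y ℤ.- x ℤ.- z) ≡ y ℤ.* + 3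
  y-from = solve-∀
  z-from : ∀ x y z w → (y ℤ.+ z ℤ.+ w) ℤ.+ (z ℤ.- x ℤ.- w) ℤ.- (y ℤ.- x ℤ.- z) ≡ z ℤ.* + 3
  z-from = solve-∀
  w-from : ∀ x y z w → (y ℤ.+ z ℤ.+ w) ℤ.- (z ℤ.- x ℤ.- w) ℤ.+ (w ℤ.- x ℤ.- y) ≡ w ℤ.* + 3
  w-from = solve-∀

-- The vectors whose reduction modulo 3 lies in the tetracode {(s, t, t - s, t + s)}.
InTetracode : ℤ⁴ → Set
InTetracode (s , t , y , z) = (+ 3 ∣ y ℤ.- (t ℤ.- s)) × (+ 3 ∣ z ℤ.- (t ℤ.+ s))

inTetracode? : ∀ v → Dec (InTetracode v)
inTetracode? (s , t , y , z) = (+ 3 ∣? y ℤ.- (t ℤ.- s)) ×-dec (+ 3 ∣? z ℤ.- (t ℤ.+ s))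

-- Modulo 3 the third and fourth rows of C are the second minus and plus the first; the multiples of
-- 3 left over are 3w and -3z.
conference-inTetracode : ∀ v → InTetracode (conference v)
conference-inTetracode (x , y , z , w) = divides w (third x y z w) , divides (- z) (fourth x y z w)
  where
  third : ∀ x y z w → (w ℤ.- x ℤ.- y) ℤ.- ((z ℤ.- x ℤ.- w) ℤ.- (y ℤ.+ z ℤ.+ w)) ≡ w ℤ.* + 3
  third = solve-∀
  fourth : ∀ x y z w → (y ℤ.- x ℤ.- z) ℤ.- ((z ℤ.- x ℤ.- w) ℤ.+ (y ℤ.+ z ℤ.+ w)) ≡ - z ℤ.* + 3
  fourth = solve-∀

-- `conference-inTetracode` shows that the quotients u and v must be the fourth coordinate and minus
-- the third one of the preimage. The first two rows of C then determine the other two.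
conference⁻¹ : ∀ v → InTetracode v → ℤ⁴
conference⁻¹ (s , t , _ , _) (divides u _ , divides v _) = - (t ℤ.+ u ℤ.+ v) , s ℤ.- u ℤ.+ v , - v , u

conference-surjective : ∀ v (v∈L : InTetracode v) → v ≡ conference (conference⁻¹ v v∈L)
conference-surjective (s , t , y , z) (divides u y≡ , divides v z≡) =
  cong₂ _,_ (first s u v) (cong₂ _,_ (second t u v) (cong₂ _,_
    (trans (restore y (t ℤ.- s)) (trans (cong (ℤ._+ (t ℤ.- s)) y≡) (third s t u v)))
    (trans (restore z (t ℤ.+ s)) (trans (cong (ℤ._+ (t ℤ.+ s)) z≡) (fourth s t u v)))))
  where
  restore : ∀ a b → a ≡ (a ℤ.- b) ℤ.+ b
  restore = solve-∀
  first : ∀ s u v → s ≡ (s ℤ.- u ℤ.+ v) ℤ.+ - v ℤ.+ u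
  first = solve-∀
  second : ∀ t u v → t ≡ - v ℤ.- - (t ℤ.+ u ℤ.+ v) ℤ.- u
  second = solve-∀
  third : ∀ s t u v → u ℤ.* + 3 ℤ.+ (t ℤ.- s) ≡ u ℤ.- - (t ℤ.+ u ℤ.+ v) ℤ.- (s ℤ.- u ℤ.+ v)
  third = solve-∀
  fourth : ∀ s t u v → v ℤ.* + 3 ℤ.+ (t ℤ.+ s) ≡ (s ℤ.- u ℤ.+ v) ℤ.- - (t ℤ.+ u ℤ.+ v) ℤ.- - v
  fourth = solve-∀

norm? : ∀ n v → Dec (norm v ≡ n)
norm? n v = norm v ≟ n

tetracode-norm? : ∀ n v → Dec (InTetracode v × norm v ≡ n)
tetracode-norm? n v = inTetracode? v ×-dec norm? n v

-- `conference` is a bijection between the two sets of vectors. Duplicate-free lists with the same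
-- members are permutations of each other, and the bound on m puts all vectors of both norms into
-- the box.
tetracode-count : ∀ {m} n → n ℕ.* 3 ℕ.≤ m →
  length (filter (norm? n) (box m)) ≡ length (filter (tetracode-norm? (n ℕ.* 3)) (box m))
tetracode-count {m} n 3n≤m = trans (sym (length-map conference xs)) (↭-length (∼bag⇒↭ (unique∧set⇒bag
  (Unique.map⁺ conference-injective (Unique.filter⁺ (norm? n) (box-unique m)))
  (Unique.filter⁺ (tetracode-norm? (n ℕ.* 3)) (box-unique m))
  (mk⇔ to from))))
  where
  xs = filter (norm? n) (box m)
  ys = filter (tetracode-norm? (n ℕ.* 3)) (box m)
  to : ∀ {v} → v ∈ map conference xs → v ∈ ys
  to v∈ with ∈-map⁻ conference v∈
  ... | w , w∈ , refl =
    ∈-filter⁺ (tetracode-norm? (n ℕ.* 3))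
      (∈-box m (conference w) (ℕₚ.≤-trans (ℕₚ.≤-reflexive norm≡) 3n≤m))
      (conference-inTetracode w , norm≡)
    where
    norm≡ : norm (conference w) ≡ n ℕ.* 3
    norm≡ = trans (conference-norm w) (cong (ℕ._* 3) (proj₂ (∈-filter⁻ (norm? n) {xs = box m} w∈)))
  from : ∀ {v} → v ∈ ys → v ∈ map conference xs
  from {v} v∈ with ∈-filter⁻ (tetracode-norm? (n ℕ.* 3)) {xs = box m} v∈
  ... | _ , v∈L , norm≡ = subst (_∈ map conference xs) (sym (conference-surjective v v∈L))
    (∈-map⁺ conference (∈-filter⁺ (norm? n)
      (∈-box m w (ℕₚ.≤-trans (ℕₚ.≤-reflexive norm-w) (ℕₚ.≤-trans (ℕₚ.m≤m*n n 3) 3n≤m))) norm-w))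
    where
    w = conference⁻¹ v v∈L
    norm-w : norm w ≡ n
    norm-w = ℕₚ.*-cancelʳ-≡ (norm w) n 3
      (trans (sym (conference-norm w)) (trans (cong norm (sym (conference-surjective v v∈L))) norm≡))

-- Theta series of the tetracode lattice

module ThetaSums where

  open Congruence 0

  private variable
    A B : Set

  ∑ : List A → (A → PS) → PS
  ∑ []       F = const 0ℤ
  ∑ (x ∷ xs) F = F x ⊕ ∑ xs F

  ∑-cong : ∀ (xs : List A) {F G : A → PS} → (∀ x → F x ≈ G x) → ∑ xs F ≈ ∑ xs G
  ∑-cong []       F≈G = ≈-refl
  ∑-cong (x ∷ xs) F≈G = +-cong (F≈G x) (∑-cong xs F≈G)

  ∑-·ˡ : ∀ (xs : List A) c (F : A → PS) → c · ∑ xs F ≈ ∑ xs (λ x → c · F x)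
  ∑-·ˡ []       c F = zeroʳ c
  ∑-·ˡ (x ∷ xs) c F = ≈-trans (distribˡ c (F x) (∑ xs F)) (+-cong ≈-refl (∑-·ˡ xs c F))

  ∑-·ʳ : ∀ (xs : List A) c (F : A → PS) → ∑ xs F · c ≈ ∑ xs (λ x → F x · c)
  ∑-·ʳ []       c F = zeroˡ c
  ∑-·ʳ (x ∷ xs) c F = ≈-trans (distribʳ c (F x) (∑ xs F)) (+-cong ≈-refl (∑-·ʳ xs c F))

  ∑-⊕ : ∀ (xs : List A) (F G : A → PS) → ∑ xs (λ x → F x ⊕ G x) ≈ ∑ xs F ⊕ ∑ xs G
  ∑-⊕ []       F G = ≈-sym (+-identityˡ _)
  ∑-⊕ (x ∷ xs) F G = ≈-trans (+-cong ≈-refl (∑-⊕ xs F G))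
    (solve 4 (λ a b c d → (a :+ b) :+ (c :+ d) := (a :+ c) :+ (b :+ d)) ≈-refl (F x) (G x) (∑ xs F) (∑ xs G))
    where open Solver

  ∑-++ : ∀ (xs ys : List A) F → ∑ (xs ++ ys) F ≈ ∑ xs F ⊕ ∑ ys F
  ∑-++ []       ys F = ≈-sym (+-identityˡ _)
  ∑-++ (x ∷ xs) ys F = ≈-trans (+-cong ≈-refl (∑-++ xs ys F)) (≈-sym (+-assoc (F x) _ _))

  ∑-map : ∀ (f : A → B) xs F → ∑ (map f xs) F ≡ ∑ xs (F ∘ f)
  ∑-map f []       F = refl
  ∑-map f (x ∷ xs) F = cong (F (f x) ⊕_) (∑-map f xs F)

  ∑-cartesianProduct : ∀ (xs : List A) (ys : List B) F →
                       ∑ (cartesianProduct xs ys) F ≈ ∑ xs (λ x → ∑ ys (λ y → F (x , y)))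
  ∑-cartesianProduct []       ys F = ≈-refl
  ∑-cartesianProduct (x ∷ xs) ys F = ≈-trans (∑-++ (map (x ,_) ys) _ F)
    (+-cong (≗⇒≈ λ n → cong (λ f → f n) (∑-map (x ,_) ys F)) (∑-cartesianProduct xs ys F))

  ∑-product : ∀ (xs : List A) (ys : List B) c F G →
              c · (∑ xs F · ∑ ys G) ≈ ∑ xs (λ x → ∑ ys (λ y → c · (F x · G y)))
  ∑-product xs ys c F G = begin
    c · (∑ xs F · ∑ ys G)                            ≈⟨ *-cong ≈-refl (∑-·ʳ xs (∑ ys G) F) ⟩
    c · ∑ xs (λ x → F x · ∑ ys G)                    ≈⟨ ∑-·ˡ xs c _ ⟩
    ∑ xs (λ x → c · (F x · ∑ ys G))                  ≈⟨ ∑-cong xs (λ x → *-cong ≈-refl (∑-·ˡ ys (F x) G)) ⟩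
    ∑ xs (λ x → c · ∑ ys (λ y → F x · G y))          ≈⟨ ∑-cong xs (λ x → ∑-·ˡ ys c (λ y → F x · G y)) ⟩
    ∑ xs (λ x → ∑ ys (λ y → c · (F x · G y)))        ∎
    where open ≈-Reasoning

  ∑-coeff-zero : ∀ (xs : List A) F k → (∀ x → F x k ≡ 0ℤ) → ∑ xs F k ≡ 0ℤ
  ∑-coeff-zero []       F zero    F≡0 = refl
  ∑-coeff-zero []       F (suc k) F≡0 = refl
  ∑-coeff-zero (x ∷ xs) F k       F≡0 = trans (⊕≗∔ (F x) (∑ xs F) k) (cong₂ ℤ._+_ (F≡0 x) (∑-coeff-zero xs F k F≡0))

  ∑-coeff-count : ∀ {P : A → Set} (P? : ∀ x → Dec (P x)) xs F k →
                  (∀ x → F x k ≡ (if does (P? x) then 1ℤ else 0ℤ)) → ∑ xs F k ≡ + length (filter P? xs)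
  ∑-coeff-count P? []       F zero    _ = refl
  ∑-coeff-count P? []       F (suc k) _ = refl
  ∑-coeff-count P? (x ∷ xs) F k F≡ with does (P? x) | F≡ x
  ... | true  | Fx≡1 = trans (⊕≗∔ (F x) (∑ xs F) k) (cong₂ ℤ._+_ Fx≡1 (∑-coeff-count P? xs F k F≡))
  ... | false | Fx≡0 = trans (⊕≗∔ (F x) (∑ xs F) k)
    (trans (cong₂ ℤ._+_ Fx≡0 (∑-coeff-count P? xs F k F≡)) (ℤₚ.+-identityˡ _))

  monomial : ℕ → PS
  monomial e k = if does (e ≟ k) then 1ℤ else 0ℤ

  monomial-0 : monomial 0 ≗ one
  monomial-0 zero    = refl
  monomial-0 (suc _) = refl

  monomial-suc : ∀ e → monomial (suc e) ≗ X · monomial e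
  monomial-suc e zero    = sym (·≗⊛ X (monomial e) 0)
  monomial-suc e (suc k) = sym (trans (·≗⊛ X (monomial e) (suc k)) (X-⊛ (monomial e) (suc k)))

  monomial-+ : ∀ d e → monomial d · monomial e ≈ monomial (d ℕ.+ e)
  monomial-+ zero    e = ≈-trans (*-cong (≗⇒≈ monomial-0) ≈-refl) (*-identityˡ _)
  monomial-+ (suc d) e = begin
    monomial (suc d) · monomial e        ≈⟨ *-cong (≗⇒≈ (monomial-suc d)) ≈-refl ⟩
    (X · monomial d) · monomial e        ≈⟨ *-assoc X _ _ ⟩
    X · (monomial d · monomial e)        ≈⟨ *-cong ≈-refl (monomial-+ d e) ⟩
    X · monomial (d ℕ.+ e)               ≈⟨ ≗⇒≈ (monomial-suc (d ℕ.+ e)) ⟨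
    monomial (suc d ℕ.+ e)               ∎
    where open ≈-Reasoning

  indicator : ∀ {P : Set} → Dec P → PS
  indicator P? = if does P? then one else const 0ℤ

  indicator-× : ∀ {P Q : Set} (P? : Dec P) (Q? : Dec Q) → indicator P? · indicator Q? ≈ indicator (P? ×-dec Q?)
  indicator-× (true  because _) Q? = *-identityˡ _
  indicator-× (false because _) Q? = zeroˡ _

  indicator-monomial : ∀ {P : Set} (P? : Dec P) e k →
                       (indicator P? · monomial e) k ≡ (if does (P? ×-dec (e ≟ k)) then 1ℤ else 0ℤ)
  indicator-monomial (true  because _) e k = ≈0⇒≗ (*-identityˡ (monomial e)) k
  indicator-monomial (false because _) e k = ≈0⇒≗ (≈-trans (zeroˡ _) (≗⇒≈ const-0)) k
  indicator-⇔ : ∀ {P Q : Set} (P? : Dec P) (Q? : Dec Q) → (P → Q) → (Q → P) → indicator P? ≈ indicator Q?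
  indicator-⇔ P? Q? f g = ≗⇒≈ λ n → cong (λ b → (if b then one else const 0ℤ) n) (does-⇔ (mk⇔ f g) P? Q?)

  indicator-true : ∀ {P : Set} (P? : Dec P) → P → indicator P? ≈ one
  indicator-true P? p = ≗⇒≈ λ n → cong (λ b → (if b then one else const 0ℤ) n) (dec-true P? p)

  indicator-false : ∀ {P : Set} (P? : Dec P) → ¬ P → indicator P? ≈ const 0ℤ
  indicator-false P? ¬p = ≗⇒≈ λ n → cong (λ b → (if b then one else const 0ℤ) n) (dec-false P? ¬p)

  q^square : ℤ → PS
  q^square x = monomial (square x)

  norm-monomial : ∀ x y z w →
    (q^square x · q^square y) · (q^square z · q^square w) ≈ monomial (norm (x , y , z , w))
  norm-monomial x y z w = begin
    (q^square x · q^square y) · (q^square z · q^square w)   ≈⟨ *-assoc _ _ _ ⟩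
    q^square x · (q^square y · (q^square z · q^square w))   ≈⟨ *-cong ≈-refl (*-cong ≈-refl (monomial-+ (square z) (square w))) ⟩
    q^square x · (q^square y · _)                           ≈⟨ *-cong ≈-refl (monomial-+ (square y) _) ⟩
    q^square x · _                                          ≈⟨ monomial-+ (square x) _ ⟩
    monomial (norm (x , y , z , w))                         ∎
    where open ≈-Reasoning

  congruent? : ∀ c x → Dec (+ 3 ∣ x ℤ.- c)
  congruent? c x = + 3 ∣? x ℤ.- c

  -- The balanced representatives 0, 1, -1 are stable under negation, the symmetry that identifies
  -- the theta series of the two nonzero classes.
  residue : ∀ x → (+ 3 ∣ x ℤ.- + 0) ⊎ (+ 3 ∣ x ℤ.- + 1) ⊎ (+ 3 ∣ x ℤ.- -[1+ 0 ])
  residue x with x ℤDivMod.%ℕ 3 | x ℤDivMod./ℕ 3 | ℤDivMod.n%ℕd<d x 3 | ℤDivMod.a≡a%ℕn+[a/ℕn]*n x 3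
  ... | 0 | q | _ | refl = inj₁ (divides q (zeroth q))
    where
    zeroth : ∀ q → + 0 ℤ.+ q ℤ.* + 3 ℤ.- + 0 ≡ q ℤ.* + 3
    zeroth = solve-∀
  ... | 1 | q | _ | refl = inj₂ (inj₁ (divides q (first q)))
    where
    first : ∀ q → + 1 ℤ.+ q ℤ.* + 3 ℤ.- + 1 ≡ q ℤ.* + 3
    first = solve-∀
  ... | 2 | q | _ | refl = inj₂ (inj₂ (divides (q ℤ.+ + 1) (second q)))
    where
    second : ∀ q → + 2 ℤ.+ q ℤ.* + 3 ℤ.- -[1+ 0 ] ≡ (q ℤ.+ + 1) ℤ.* + 3
    second = solve-∀
  ... | suc (suc (suc _)) | _ | s≤s (s≤s (s≤s ())) | _

  distinct-classes : ∀ {x} c c′ → ¬ (+ 3 ∣ c ℤ.- c′) → + 3 ∣ x ℤ.- c′ → ¬ (+ 3 ∣ x ℤ.- c)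
  distinct-classes {x} c c′ 3∤ h′ h = 3∤ (subst (+ 3 ∣_) (difference x c c′) (∣m∣n⇒∣m-n h′ h))
    where
    difference : ∀ x c c′ → (x ℤ.- c′) ℤ.- (x ℤ.- c) ≡ c ℤ.- c′
    difference = solve-∀

  module Truncated (m : ℕ) where

    I : List ℤ
    I = interval m

    θ : PS
    θ = ∑ I q^square

    θ-class : ℤ → PS
    θ-class c = ∑ I (λ x → indicator (congruent? c x) · q^square x)

    Periodic : (ℤ → PS) → Set
    Periodic G = ∀ c c′ → + 3 ∣ c ℤ.- c′ → G c ≈ G c′

    θ-class-periodic : Periodic θ-class
    θ-class-periodic c c′ 3∣ = ∑-cong I λ x → *-cong
      (indicator-⇔ (congruent? c x) (congruent? c′ x)
        (λ h → subst (+ 3 ∣_) (sum x c c′) (∣m∣n⇒∣m+n h 3∣))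
        (λ h → subst (+ 3 ∣_) (difference x c c′) (∣m∣n⇒∣m-n h 3∣)))
      ≈-refl
      where
      sum : ∀ x c c′ → (x ℤ.- c) ℤ.+ (c ℤ.- c′) ≡ x ℤ.- c′
      sum = solve-∀
      difference : ∀ x c c′ → (x ℤ.- c′) ℤ.- (c ℤ.- c′) ≡ x ℤ.- c
      difference = solve-∀

    ∑-reflect : ∀ m F → ∑ (interval m) F ≈ ∑ (interval m) (F ∘ -_)
    ∑-reflect zero    F = ≈-refl
    ∑-reflect (suc m) F = ≈-trans (+-cong ≈-refl (+-cong ≈-refl (∑-reflect m F)))
      (solve 3 (λ a b c → a :+ (b :+ c) := b :+ (a :+ c)) ≈-refl (F (+ suc m)) (F -[1+ m ]) _)
      where open Solver

    -- The reflection of x to -x preserves both the interval and the squares.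
    θ-class-neg : ∀ c → θ-class c ≈ θ-class (- c)
    θ-class-neg c = ≈-trans (∑-reflect m _) (∑-cong I λ x → *-cong
      (indicator-⇔ (congruent? c (- x)) (congruent? (- c) x)
        (λ h → subst (+ 3 ∣_) (negate x c) (∣m⇒∣-m h))
        (λ h → subst (+ 3 ∣_) (negate′ x c) (∣m⇒∣-m h)))
      (≗⇒≈ λ n → cong (λ k → monomial (k ℕ.* k) n) (ℤₚ.∣-i∣≡∣i∣ x)))
      where
      negate : ∀ x c → - (- x ℤ.- c) ≡ x ℤ.- - c
      negate = solve-∀
      negate′ : ∀ x c → - (x ℤ.- - c) ≡ - x ℤ.- c
      negate′ = solve-∀

    -- The indicators of the three classes form a partition of unity, and on each class `G` may be
    -- replaced by its value at the representative.
    ∑-by-class : ∀ G → Periodic G →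
      ∑ I (λ x → q^square x · G x) ≈
      θ-class (+ 0) · G (+ 0) ⊕ (θ-class (+ 1) · G (+ 1) ⊕ θ-class -[1+ 0 ] · G -[1+ 0 ])
    ∑-by-class G periodic = ≈-sym (begin
      θ-class (+ 0) · G (+ 0) ⊕ (θ-class (+ 1) · G (+ 1) ⊕ θ-class -[1+ 0 ] · G -[1+ 0 ])
        ≈⟨ +-cong (∑-·ʳ I _ _) (+-cong (∑-·ʳ I _ _) (∑-·ʳ I _ _)) ⟩
      ∑ I (summand (+ 0)) ⊕ (∑ I (summand (+ 1)) ⊕ ∑ I (summand -[1+ 0 ]))
        ≈⟨ +-cong ≈-refl (∑-⊕ I (summand (+ 1)) (summand -[1+ 0 ])) ⟨
      ∑ I (summand (+ 0)) ⊕ ∑ I (λ x → summand (+ 1) x ⊕ summand -[1+ 0 ] x)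
        ≈⟨ ∑-⊕ I (summand (+ 0)) _ ⟨
      ∑ I (λ x → summand (+ 0) x ⊕ (summand (+ 1) x ⊕ summand -[1+ 0 ] x))
        ≈⟨ ∑-cong I pointwise ⟩
      ∑ I (λ x → q^square x · G x) ∎)
      where
      open ≈-Reasoning
      summand : ℤ → ℤ → PS
      summand c x = (indicator (congruent? c x) · q^square x) · G c

      hit : ∀ {x} c → + 3 ∣ x ℤ.- c → summand c x ≈ q^square x · G x
      hit {x} c h = *-cong (≈-trans (*-cong (indicator-true (congruent? c x) h) ≈-refl) (*-identityˡ _))
                           (≈-sym (periodic x c h))

      miss : ∀ {x} c c′ → ¬ (+ 3 ∣ c ℤ.- c′) → + 3 ∣ x ℤ.- c′ → summand c x ≈ const 0ℤ
      miss {x} c c′ 3∤ h = ≈-trans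
        (*-cong (≈-trans (*-cong (indicator-false (congruent? c x) (distinct-classes {x} c c′ 3∤ h)) ≈-refl) (zeroˡ _)) ≈-refl)
        (zeroˡ _)

      pointwise : ∀ x → summand (+ 0) x ⊕ (summand (+ 1) x ⊕ summand -[1+ 0 ] x) ≈ q^square x · G x
      pointwise x with residue x
      ... | inj₁ h = ≈-trans
        (+-cong (hit {x} (+ 0) h)
          (+-cong (miss {x} (+ 1) (+ 0) (from-no (+ 3 ∣? + 1)) h) (miss {x} -[1+ 0 ] (+ 0) (from-no (+ 3 ∣? -[1+ 0 ])) h)))
        (solve 1 (λ a → a :+ (con 0ℤ :+ con 0ℤ) := a) ≈-refl _)
        where open Solver
      ... | inj₂ (inj₁ h) = ≈-trans
        (+-cong (miss {x} (+ 0) (+ 1) (from-no (+ 3 ∣? -[1+ 0 ])) h)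
          (+-cong (hit {x} (+ 1) h) (miss {x} -[1+ 0 ] (+ 1) (from-no (+ 3 ∣? -[1+ 1 ])) h)))
        (solve 1 (λ a → con 0ℤ :+ (a :+ con 0ℤ) := a) ≈-refl _)
        where open Solver
      ... | inj₂ (inj₂ h) = ≈-trans
        (+-cong (miss {x} (+ 0) -[1+ 0 ] (from-no (+ 3 ∣? + 1)) h)
          (+-cong (miss {x} (+ 1) -[1+ 0 ] (from-no (+ 3 ∣? + 2)) h) (hit {x} -[1+ 0 ] h)))
        (solve 1 (λ a → con 0ℤ :+ (con 0ℤ :+ a) := a) ≈-refl _)
        where open Solver

    θ₀ θ₁ : PS
    θ₀ = θ-class (+ 0)
    θ₁ = θ-class (+ 1)

    θ₋₁≈θ₁ : θ-class -[1+ 0 ] ≈ θ₁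
    θ₋₁≈θ₁ = ≈-sym (θ-class-neg (+ 1))

    θ₂≈θ₁ : θ-class (+ 2) ≈ θ₁
    θ₂≈θ₁ = ≈-trans (θ-class-periodic (+ 2) -[1+ 0 ] (divides (+ 1) refl)) θ₋₁≈θ₁

    θ₋₂≈θ₁ : θ-class -[1+ 1 ] ≈ θ₁
    θ₋₂≈θ₁ = θ-class-periodic -[1+ 1 ] (+ 1) (divides -[1+ 0 ] refl)

    θ-decomposition : θ ≈ θ₀ ⊕ (θ₁ ⊕ θ₁)
    θ-decomposition = begin
      ∑ I q^square                          ≈⟨ ∑-cong I (λ x → solve 1 (λ a → a := a :* con 1ℤ) ≈-refl (q^square x)) ⟩
      ∑ I (λ x → q^square x · const 1ℤ)     ≈⟨ ∑-by-class (λ _ → const 1ℤ) (λ _ _ _ → ≈-refl) ⟩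
      θ₀ · const 1ℤ ⊕ (θ₁ · const 1ℤ ⊕ θ-class -[1+ 0 ] · const 1ℤ)
                                            ≈⟨ +-cong ≈-refl (+-cong ≈-refl (*-cong θ₋₁≈θ₁ ≈-refl)) ⟩
      θ₀ · const 1ℤ ⊕ (θ₁ · const 1ℤ ⊕ θ₁ · const 1ℤ)
                                            ≈⟨ solve 2 (λ a b → a :* con 1ℤ :+ (b :* con 1ℤ :+ b :* con 1ℤ) := a :+ (b :+ b)) ≈-refl θ₀ θ₁ ⟩
      θ₀ ⊕ (θ₁ ⊕ θ₁)                        ∎
      where
      open ≈-Reasoning
      open Solver

    ∑-box : ∀ F → ∑ (box m) F ≈ ∑ I (λ s → ∑ I (λ t → ∑ I (λ y → ∑ I (λ z → F (s , t , y , z)))))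
    ∑-box F = ≈-trans (∑-cartesianProduct I (cartesianProduct I (cartesianProduct I I)) F) (∑-cong I λ s →
      ≈-trans (∑-cartesianProduct I (cartesianProduct I I) (λ v → F (s , v))) (∑-cong I λ t →
        ∑-cartesianProduct I I (λ v → F (s , t , v))))

    -- For fixed s and t the last two coordinates range freely over the classes of t - s and t + s,
    -- so the sum depends only on the nine pairs (s, t) modulo 3. The zero word gives θ₀⁴. Each of
    -- the other eight words has exactly one zero coordinate and gives θ₀ θ₁³, and the factor 8 is
    -- absorbed into (θ₁ + θ₁)³.
    tetracode-enumerator :
      ∑ (box m) (λ v → indicator (inTetracode? v) · monomial (norm v)) ≈
      (θ₀ · (θ₀ · (θ₀ · θ₀))) ⊕ (θ₀ · ((θ₁ ⊕ θ₁) · ((θ₁ ⊕ θ₁) · (θ₁ ⊕ θ₁))))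
    tetracode-enumerator = begin
      ∑ (box m) (λ v → indicator (inTetracode? v) · monomial (norm v))
        ≈⟨ ∑-box _ ⟩
      ∑ I (λ s → ∑ I (λ t → ∑ I (λ y → ∑ I (λ z →
        indicator (inTetracode? (s , t , y , z)) · monomial (norm (s , t , y , z))))))
        ≈⟨ ∑-cong I (λ s → ∑-cong I λ t → ∑-cong I λ y → ∑-cong I λ z → separate s t y z) ⟩
      ∑ I (λ s → ∑ I (λ t → ∑ I (λ y → ∑ I (λ z → (q^square s · q^square t) ·
        ((indicator (congruent? (t ℤ.- s) y) · q^square y) · (indicator (congruent? (t ℤ.+ s) z) · q^square z))))))
        ≈⟨ ∑-cong I (λ s → ∑-cong I λ t → ∑-product I I (q^square s · q^square t) _ _) ⟨
      ∑ I (λ s → ∑ I (λ t → (q^square s · q^square t) · (θ-class (t ℤ.- s) · θ-class (t ℤ.+ s))))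
        ≈⟨ ∑-cong I (λ s → ∑-cong I λ t → *-assoc _ _ _) ⟩
      ∑ I (λ s → ∑ I (λ t → q^square s · (q^square t · (θ-class (t ℤ.- s) · θ-class (t ℤ.+ s)))))
        ≈⟨ ∑-cong I (λ s → ∑-·ˡ I (q^square s) _) ⟨
      ∑ I (λ s → q^square s · ∑ I (λ t → q^square t · (θ-class (t ℤ.- s) · θ-class (t ℤ.+ s))))
        ≈⟨ ∑-cong I (λ s → *-cong ≈-refl (∑-by-class _ (λ c c′ h →
             *-cong (θ-class-periodic _ _ (subst (+ 3 ∣_) (minus c c′ s) h))
                    (θ-class-periodic _ _ (subst (+ 3 ∣_) (plus c c′ s) h))))) ⟩
      ∑ I (λ s → q^square s · codewords s)
        ≈⟨ ∑-by-class codewords (λ c c′ h →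
             +-cong (codeword-cong c c′ h (+ 0)) (+-cong (codeword-cong c c′ h (+ 1)) (codeword-cong c c′ h -[1+ 0 ]))) ⟩
      θ₀ · codewords (+ 0) ⊕ (θ₁ · codewords (+ 1) ⊕ θ₋₁ · codewords -[1+ 0 ])
        -- The sums t ± s of representatives reach 2 and -2; these classes and that of -1 all have
        -- the theta series θ₁.
        ≈⟨ +-cong
             (*-cong ≈-refl (+-cong ≈-refl (+-cong ≈-refl (*-cong θ₋₁≈θ₁ (*-cong θ₋₁≈θ₁ θ₋₁≈θ₁)))))
             (+-cong
               (*-cong ≈-refl (+-cong (*-cong ≈-refl (*-cong θ₋₁≈θ₁ ≈-refl))
                 (+-cong (*-cong ≈-refl (*-cong ≈-refl θ₂≈θ₁)) (*-cong θ₋₁≈θ₁ (*-cong θ₋₂≈θ₁ ≈-refl)))))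
               (*-cong θ₋₁≈θ₁ (+-cong (*-cong ≈-refl (*-cong ≈-refl θ₋₁≈θ₁))
                 (+-cong (*-cong ≈-refl (*-cong θ₂≈θ₁ ≈-refl)) (*-cong θ₋₁≈θ₁ (*-cong ≈-refl θ₋₂≈θ₁)))))) ⟩
      _
        ≈⟨ solve 2 (λ a b →
             a :* (a :* (a :* a) :+ (b :* (b :* b) :+ b :* (b :* b))) :+
               (b :* (a :* (b :* b) :+ (b :* (a :* b) :+ b :* (b :* a))) :+
                b :* (a :* (b :* b) :+ (b :* (b :* a) :+ b :* (a :* b))))
             := (a :* (a :* (a :* a))) :+ (a :* ((b :+ b) :* ((b :+ b) :* (b :+ b))))) ≈-refl θ₀ θ₁ ⟩
      (θ₀ · (θ₀ · (θ₀ · θ₀))) ⊕ (θ₀ · ((θ₁ ⊕ θ₁) · ((θ₁ ⊕ θ₁) · (θ₁ ⊕ θ₁)))) ∎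
      where
      open ≈-Reasoning
      open Solver
      θ₋₁ = θ-class -[1+ 0 ]

      minus : ∀ c c′ s → c ℤ.- c′ ≡ (c ℤ.- s) ℤ.- (c′ ℤ.- s)
      minus = solve-∀
      plus : ∀ c c′ s → c ℤ.- c′ ≡ (c ℤ.+ s) ℤ.- (c′ ℤ.+ s)
      plus = solve-∀

      codeword : ℤ → ℤ → PS
      codeword s t = θ-class t · (θ-class (t ℤ.- s) · θ-class (t ℤ.+ s))

      codewords : ℤ → PS
      codewords s = codeword s (+ 0) ⊕ (codeword s (+ 1) ⊕ codeword s -[1+ 0 ])

      codeword-cong : ∀ s s′ → + 3 ∣ s ℤ.- s′ → ∀ t → codeword s t ≈ codeword s′ t
      codeword-cong s s′ h t = *-cong ≈-refl (*-cong
        (θ-class-periodic _ _ (subst (+ 3 ∣_) (minus′ s s′ t) (∣m⇒∣-m h)))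
        (θ-class-periodic _ _ (subst (+ 3 ∣_) (plus′ s s′ t) h)))
        where
        minus′ : ∀ s s′ t → - (s ℤ.- s′) ≡ (t ℤ.- s) ℤ.- (t ℤ.- s′)
        minus′ = solve-∀
        plus′ : ∀ s s′ t → s ℤ.- s′ ≡ (t ℤ.+ s) ℤ.- (t ℤ.+ s′)
        plus′ = solve-∀

      separate : ∀ s t y z →
        indicator (inTetracode? (s , t , y , z)) · monomial (norm (s , t , y , z)) ≈
        (q^square s · q^square t) ·
          ((indicator (congruent? (t ℤ.- s) y) · q^square y) · (indicator (congruent? (t ℤ.+ s) z) · q^square z))
      separate s t y z = ≈-trans
        (*-cong (≈-sym (indicator-× (congruent? (t ℤ.- s) y) (congruent? (t ℤ.+ s) z))) (≈-sym (norm-monomial s t y z)))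
        (solve 6 (λ i j a b c d → (i :* j) :* ((a :* b) :* (c :* d)) := (a :* b) :* ((i :* c) :* (j :* d))) ≈-refl
          (indicator (congruent? (t ℤ.- s) y)) (indicator (congruent? (t ℤ.+ s) z))
          (q^square s) (q^square t) (q^square y) (q^square z))

-- From truncated theta sums to φ

open ThetaSums

square-class₀ : ∀ {x} → + 3 ∣ x ℤ.- + 0 → square x % 3 ≡ 0
square-class₀ {x} 3∣ with ∣⇒∣ᵤ (subst (+ 3 ∣_) (ℤₚ.+-identityʳ x) 3∣)
... | ℕ∣.divides j ∣x∣≡ = trans (square-%3 ∣ x ∣)
  (cong (λ r → r ℕ.* r % 3) (trans (cong (_% 3) ∣x∣≡) (DivMod.m*n%n≡0 j 3)))

square-class₁ : ∀ {x} → + 3 ∣ x ℤ.- + 1 → square x % 3 ≡ 1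
square-class₁ {x} 3∣ = trans (square-%3 ∣ x ∣) (unit-square (∣ x ∣ % 3) (DivMod.m%n<n ∣ x ∣ 3) λ r≡0 →
  distinct-classes {x} (+ 0) (+ 1) (from-no (+ 3 ∣? -[1+ 0 ])) 3∣
    (subst (+ 3 ∣_) (sym (ℤₚ.+-identityʳ x)) (∣ᵤ⇒∣ (ℕ∣.m%n≡0⇒n∣m ∣ x ∣ 3 r≡0))))
  where
  unit-square : ∀ r → r ℕ.< 3 → r ≢ 0 → r ℕ.* r % 3 ≡ 1
  unit-square 0 _ r≢0 = ⊥-elim (r≢0 refl)
  unit-square 1 _ _ = refl
  unit-square 2 _ _ = refl
  unit-square (suc (suc (suc _))) (s≤s (s≤s (s≤s ()))) _

module _ (m : ℕ) where
  open Truncated m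

  θ-class-vanishes : ∀ c k → (∀ x → + 3 ∣ x ℤ.- c → square x ≢ k) → θ-class c k ≡ 0ℤ
  θ-class-vanishes c k none = ∑-coeff-zero I _ k λ x → trans (indicator-monomial (congruent? c x) (square x) k)
    (cong (if_then 1ℤ else 0ℤ) (dec-false (congruent? c x ×-dec (square x ≟ k)) λ (h , eq) → none x h eq))

  θ₀-vanishes : ∀ k → k % 3 ≢ 0 → θ₀ k ≡ 0ℤ
  θ₀-vanishes k k≢0 = θ-class-vanishes (+ 0) k λ x h eq → k≢0 (trans (cong (_% 3) (sym eq)) (square-class₀ {x} h))

  θ₁-vanishes : ∀ k → k % 3 ≢ 1 → θ₁ k ≡ 0ℤ
  θ₁-vanishes k k≢1 = θ-class-vanishes (+ 1) k λ x h eq → k≢1 (trans (cong (_% 3) (sym eq)) (square-class₁ {x} h))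

θ-sumTo : ∀ m k → Truncated.θ m k ≡ sumTo m (φ-term k)
θ-sumTo zero    k = trans (⊕≗∔ (q^square 0ℤ) (const 0ℤ) k) (add-zero refl (const-0 k))
θ-sumTo (suc m) k = begin
  (q^square (+ suc m) ⊕ (q^square -[1+ m ] ⊕ Truncated.θ m)) k
    ≡⟨ trans (⊕≗∔ _ _ k) (cong (λ z → q^square (+ suc m) k ℤ.+ z) (⊕≗∔ _ _ k)) ⟩
  q^square (+ suc m) k ℤ.+ (q^square -[1+ m ] k ℤ.+ Truncated.θ m k)
    ≡⟨ pair (does (suc m ℕ.* suc m ≟ k)) (Truncated.θ m k) ⟩
  Truncated.θ m k ℤ.+ φ-term k (suc m)
    ≡⟨ cong (ℤ._+ φ-term k (suc m)) (θ-sumTo m k) ⟩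
  sumTo m (φ-term k) ℤ.+ φ-term k (suc m) ∎
  where
  open ≡-Reasoning
  pair : ∀ b s → (if b then 1ℤ else 0ℤ) ℤ.+ ((if b then 1ℤ else 0ℤ) ℤ.+ s) ≡ s ℤ.+ (if b then + 2 else 0ℤ)
  pair true  = two
    where
    two : ∀ s → 1ℤ ℤ.+ (1ℤ ℤ.+ s) ≡ s ℤ.+ + 2
    two = solve-∀
  pair false = none
    where
    none : ∀ s → 0ℤ ℤ.+ (0ℤ ℤ.+ s) ≡ s ℤ.+ 0ℤ
    none = solve-∀

θ≡φ : ∀ {m k} → k ℕ.≤ m → Truncated.θ m k ≡ φ k
θ≡φ {m} {k} k≤m = trans (θ-sumTo m k) (φ-truncate k≤m)

-- Named after the base k in q^(k²): a multiple of 3, or a unit modulo 3.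
φ-multiples φ-units : PS
φ-multiples = sub3 (sub3 φ)
φ-units     = X · sub3 β

φ≗multiples⊕units : φ ≗ φ-multiples ⊕ φ-units
φ≗multiples⊕units n = trans (φ-3-dissection n)
  (sym (trans (⊕≗∔ φ-multiples φ-units n) (cong (λ z → φ-multiples n ℤ.+ z) (·≗⊛ X (sub3 β) n))))

module _ (m : ℕ) where
  open Truncated m

  -- Both sides split the same total φ. In every residue class of degrees the two first parts or the
  -- two second parts vanish together, and the total then fixes the remaining pair.
  θ-classes≡ : ∀ k → k ℕ.≤ m → (θ₀ k ≡ φ-multiples k) × ((θ₁ ⊕ θ₁) k ≡ φ-units k)
  θ-classes≡ = residue-cases _
    (λ j j≤m → let units₀ = zero-pair (j ℕ.* 3) (θ₁-vanishes m (j ℕ.* 3) (zero-residue j))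
                   φ-units₀ = trans (·≗⊛ X (sub3 β) (j ℕ.* 3)) (X-sub3-0 β j)
      in cancelʳ (total (j ℕ.* 3) j≤m) (trans units₀ (sym φ-units₀)) , trans units₀ (sym φ-units₀))
    (λ j j≤m → let multiples₁ = trans (θ₀-vanishes m (1 ℕ.+ j ℕ.* 3) (unit-residue 1 j)) (sym (sub3-1 (sub3 φ) j))
      in multiples₁ , cancelˡ (total (1 ℕ.+ j ℕ.* 3) j≤m) multiples₁)
    (λ j j≤m → let multiples₂ = trans (θ₀-vanishes m (2 ℕ.+ j ℕ.* 3) (unit-residue 2 j)) (sym (sub3-2 (sub3 φ) j))
      in multiples₂ , cancelˡ (total (2 ℕ.+ j ℕ.* 3) j≤m) multiples₂)
    where
    zero-residue : ∀ j → (j ℕ.* 3) % 3 ≢ 1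
    zero-residue j eq with trans (sym (DivMod.m*n%n≡0 j 3)) eq
    ... | ()
    unit-residue : ∀ r j .{{_ : ℕ.NonZero (r % 3)}} → (r ℕ.+ j ℕ.* 3) % 3 ≢ 0
    unit-residue r j eq = ℕ.≢-nonZero⁻¹ (r % 3) (trans (sym (DivMod.[m+kn]%n≡m%n r j 3)) eq)
    zero-pair : ∀ k → θ₁ k ≡ 0ℤ → (θ₁ ⊕ θ₁) k ≡ 0ℤ
    zero-pair k θ₁≡0 = trans (⊕≗∔ θ₁ θ₁ k) (cong₂ ℤ._+_ θ₁≡0 θ₁≡0)
    total : ∀ k → k ℕ.≤ m → θ₀ k ℤ.+ (θ₁ ⊕ θ₁) k ≡ φ-multiples k ℤ.+ φ-units k
    total k k≤m = begin
      θ₀ k ℤ.+ (θ₁ ⊕ θ₁) k              ≡⟨ ⊕≗∔ θ₀ (θ₁ ⊕ θ₁) k ⟨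
      (θ₀ ⊕ (θ₁ ⊕ θ₁)) k                ≡⟨ ≈0⇒≗ θ-decomposition k ⟨
      θ k                               ≡⟨ θ≡φ k≤m ⟩
      φ k                               ≡⟨ φ≗multiples⊕units k ⟩
      (φ-multiples ⊕ φ-units) k         ≡⟨ ⊕≗∔ φ-multiples φ-units k ⟩
      φ-multiples k ℤ.+ φ-units k       ∎
      where open ≡-Reasoning
    cancelʳ : ∀ {a b c d} → a ℤ.+ c ≡ b ℤ.+ d → c ≡ d → a ≡ b
    cancelʳ {a} {b} {c} eq refl = ∙-cancelʳ c a b eq
    cancelˡ : ∀ {a b c d} → a ℤ.+ c ≡ b ℤ.+ d → a ≡ b → c ≡ d
    cancelˡ {a} {b} {c} {d} eq refl = ∙-cancelˡ a c d eq

·-cong-≤ : ∀ {m f f′ g g′} → (∀ k → k ℕ.≤ m → f k ≡ f′ k) → (∀ k → k ℕ.≤ m → g k ≡ g′ k) →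
           ∀ k → k ℕ.≤ m → (f · g) k ≡ (f′ · g′) k
·-cong-≤ {f = f} {f′} {g} {g′} f≡ g≡ k k≤m = trans (·≗⊛ f g k) (trans
  (⊛-cong-≤ k (λ j j≤k → f≡ j (ℕₚ.≤-trans j≤k k≤m)) (λ j j≤k → g≡ j (ℕₚ.≤-trans j≤k k≤m)))
  (sym (·≗⊛ f′ g′ k)))

⊕-cong-≤ : ∀ {m f f′ g g′} → (∀ k → k ℕ.≤ m → f k ≡ f′ k) → (∀ k → k ℕ.≤ m → g k ≡ g′ k) →
           ∀ k → k ℕ.≤ m → (f ⊕ g) k ≡ (f′ ⊕ g′) k
⊕-cong-≤ {f = f} {f′} {g} {g′} f≡ g≡ k k≤m = trans (⊕≗∔ f g k) (trans
  (cong₂ ℤ._+_ (f≡ k k≤m) (g≡ k k≤m)) (sym (⊕≗∔ f′ g′ k)))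

φ⁴-as-norms : ∀ m → (Truncated.θ m · Truncated.θ m) · (Truncated.θ m · Truncated.θ m) ≈[ 0 ] ∑ (box m) (monomial ∘ norm)
φ⁴-as-norms m = ≈-sym (begin
  ∑ (box m) (monomial ∘ norm)
    ≈⟨ ∑-box (monomial ∘ norm) ⟩
  ∑ I (λ s → ∑ I (λ t → ∑ I (λ y → ∑ I (λ z → monomial (norm (s , t , y , z))))))
    ≈⟨ ∑-cong I (λ s → ∑-cong I λ t → ∑-cong I λ y → ∑-cong I λ z → norm-monomial s t y z) ⟨
  ∑ I (λ s → ∑ I (λ t → ∑ I (λ y → ∑ I (λ z → (q^square s · q^square t) · (q^square y · q^square z)))))
    ≈⟨ ∑-cong I (λ s → ∑-cong I λ t → ∑-product I I (q^square s · q^square t) q^square q^square) ⟨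
  ∑ I (λ s → ∑ I (λ t → (q^square s · q^square t) · (θ · θ)))
    ≈⟨ ∑-cong I (λ s → ∑-cong I λ t → *-comm (q^square s · q^square t) (θ · θ)) ⟩
  ∑ I (λ s → ∑ I (λ t → (θ · θ) · (q^square s · q^square t)))
    ≈⟨ ∑-product I I (θ · θ) q^square q^square ⟨
  (θ · θ) · (θ · θ) ∎)
  where
  open Congruence 0
  open ≈-Reasoning
  open Truncated m

-- The n-th coefficient on the left counts the vectors of norm 3n over the tetracode, on the right
-- all vectors of norm n, and `conference` matches them. A single box of half-width 3n serves both
-- counts.
quartic-section : section 0 ((φ-multiples · (φ-multiples · (φ-multiples · φ-multiples)))
                             ⊕ (φ-multiples · (φ-units · (φ-units · φ-units))))
                  ≗ (φ · φ) · (φ · φ)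
quartic-section n = begin
  ((φ-multiples · (φ-multiples · (φ-multiples · φ-multiples)))
    ⊕ (φ-multiples · (φ-units · (φ-units · φ-units)))) (n ℕ.* 3)
    ≡⟨ ⊕-cong-≤
         (·-cong-≤ multiples (·-cong-≤ multiples (·-cong-≤ multiples multiples)))
         (·-cong-≤ multiples (·-cong-≤ units (·-cong-≤ units units))) m ℕₚ.≤-refl ⟨
  ((θ₀ · (θ₀ · (θ₀ · θ₀))) ⊕ (θ₀ · ((θ₁ ⊕ θ₁) · ((θ₁ ⊕ θ₁) · (θ₁ ⊕ θ₁))))) m
    ≡⟨ ≈0⇒≗ tetracode-enumerator m ⟨
  ∑ (box m) (λ v → indicator (inTetracode? v) · monomial (norm v)) m
    ≡⟨ ∑-coeff-count (tetracode-norm? m) (box m) _ m (λ v → indicator-monomial (inTetracode? v) (norm v) m) ⟩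
  + length (filter (tetracode-norm? m) (box m))
    ≡⟨ cong +_ (tetracode-count n ℕₚ.≤-refl) ⟨
  + length (filter (norm? n) (box m))
    ≡⟨ ∑-coeff-count (norm? n) (box m) (monomial ∘ norm) n (λ _ → refl) ⟨
  ∑ (box m) (monomial ∘ norm) n
    ≡⟨ ≈0⇒≗ (φ⁴-as-norms m) n ⟨
  ((θ · θ) · (θ · θ)) n
    ≡⟨ ·-cong-≤ (·-cong-≤ θs θs) (·-cong-≤ θs θs) n (ℕₚ.m≤m*n n 3) ⟩
  ((φ · φ) · (φ · φ)) n ∎
  where
  open ≡-Reasoning
  m = n ℕ.* 3
  open Truncated m
  multiples : ∀ k → k ℕ.≤ m → θ₀ k ≡ φ-multiples k
  multiples k k≤m = proj₁ (θ-classes≡ m k k≤m)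
  units : ∀ k → k ℕ.≤ m → (θ₁ ⊕ θ₁) k ≡ φ-units k
  units k k≤m = proj₂ (θ-classes≡ m k k≤m)
  θs : ∀ k → k ℕ.≤ m → θ k ≡ φ k
  θs k = θ≡φ {m}

-- Congruences

infixr 8 _^·_

-- Powers over the opaque product, unfolding in the same way as the `:^` of the solver.
_^·_ : PS → ℕ → PS
f ^· zero  = one
f ^· suc k = f · f ^· k

^^≗^· : ∀ f k → f ^^ k ≗ f ^· k
^^≗^· f zero    n = refl
^^≗^· f (suc k) n = trans (⊛-cong {f} (λ _ → refl) (^^≗^· f k) n) (sym (·≗⊛ f (f ^· k) n))

·-inv : ∀ m f k → f 0 ≡ 1ℤ → (f ^· k) · inv (f ^^ k) ≈[ m ] one
·-inv m f k f0≡1 = ≗⇒≈ λ n → trans (·≗⊛ (f ^· k) (inv (f ^^ k)) n) (trans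
  (⊛-cong {g = inv (f ^^ k)} (λ j → sym (^^≗^· f k j)) (λ _ → refl) n)
  (⊛-inv (f ^^ k) (constant-term k) n))
  where
  open Congruence m
  constant-term : ∀ k → (f ^^ k) 0 ≡ 1ℤ
  constant-term zero    = refl
  constant-term (suc k) = cong₂ ℤ._*_ f0≡1 (constant-term k)

a : PS
a = sub3 φ

p̄ : PS
p̄ = subNeg pbar3

-- The operator U on powers of φ

module Sections (m : ℕ) where
  open Congruence m

  section-cong : ∀ i {f g} → f ≈ g → section i f ≈ section i g
  section-cong i h = congruent λ n → coeff h (i ℕ.+ n ℕ.* 3)

  sub3-cong≈ : ∀ {f g} → f ≈ g → sub3 f ≈ sub3 g
  sub3-cong≈ {f} {g} h = congruent (residue-cases _
    (λ n → subst₂ (λ x y → m ℕ∣.∣ ∣ x ℤ.- y ∣) (sym (sub3-0 f n)) (sym (sub3-0 g n)) (coeff h n))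
    (λ n → subst₂ (λ x y → m ℕ∣.∣ ∣ x ℤ.- y ∣) (sym (sub3-1 f n)) (sym (sub3-1 g n)) (m ℕ∣.∣0))
    (λ n → subst₂ (λ x y → m ℕ∣.∣ ∣ x ℤ.- y ∣) (sym (sub3-2 f n)) (sym (sub3-2 g n)) (m ℕ∣.∣0)))

  section-⊕ : ∀ i f g → section i (f ⊕ g) ≈ section i f ⊕ section i g
  section-⊕ i f g = ≗⇒≈ λ n →
    trans (⊕≗∔ f g (i ℕ.+ n ℕ.* 3)) (sym (⊕≗∔ (section i f) (section i g) n))

  private
    via-⊛ : ∀ i f g h k → (∀ n → section i (f ⊛ g) n ≡ (h ⊛ k) n) → section i (f · g) ≈ h · k
    via-⊛ i f g h k eq = ≗⇒≈ λ n → trans (·≗⊛ f g (i ℕ.+ n ℕ.* 3)) (trans (eq n) (sym (·≗⊛ h k n)))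

  section₀-sub3-· : ∀ f g → section 0 (sub3 f · g) ≈ f · section 0 g
  section₀-sub3-· f g = via-⊛ 0 (sub3 f) g f (section 0 g) (section₀-sub3-⊛ f g)

  section₁-sub3-· : ∀ f g → section 1 (sub3 f · g) ≈ f · section 1 g
  section₁-sub3-· f g = via-⊛ 1 (sub3 f) g f (section 1 g) (section₁-sub3-⊛ f g)

  section₂-sub3-· : ∀ f g → section 2 (sub3 f · g) ≈ f · section 2 g
  section₂-sub3-· f g = via-⊛ 2 (sub3 f) g f (section 2 g) (section₂-sub3-⊛ f g)

  section₀-X· : ∀ f → section 0 (X · f) ≈ X · section 2 f
  section₀-X· f = via-⊛ 0 X f X (section 2 f) (section₀-X f)

  section₁-X· : ∀ f → section 1 (X · f) ≈ section 0 f
  section₁-X· f = ≗⇒≈ λ n → trans (·≗⊛ X f (1 ℕ.+ n ℕ.* 3)) (section₁-X f n)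

  section₂-X· : ∀ f → section 2 (X · f) ≈ section 1 f
  section₂-X· f = ≗⇒≈ λ n → trans (·≗⊛ X f (2 ℕ.+ n ℕ.* 3)) (section₂-X f n)

  section-sub3 : ∀ f → section 0 (sub3 f) ≈ f
  section-sub3 f = ≗⇒≈ (sub3-0 f)

  φ-split : ∀ f → φ · f ≈ sub3 a · f ⊕ X · (sub3 β · f)
  φ-split f = ≈-trans (*-cong (≗⇒≈ φ≗multiples⊕units) ≈-refl)
    (solve 4 (λ A x B f → (A :+ x :* B) :* f := A :* f :+ x :* (B :* f)) ≈-refl (sub3 a) X (sub3 β) f)
    where open Solver

  section-φ· : ∀ i f → section i (φ · f) ≈ section i (sub3 a · f) ⊕ section i (X · (sub3 β · f))
  section-φ· i f = ≈-trans (section-cong i (φ-split f)) (section-⊕ i (sub3 a · f) (X · (sub3 β · f)))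

  -- The k-th power of a + tβ with t³ = X, sorted by the exponent of t modulo 3; t plays the part of
  -- the q in φ = a(q³) + q β(q³).
  s₀ s₁ s₂ : ℕ → PS
  s₀ zero    = const 1ℤ
  s₀ (suc k) = a · s₀ k ⊕ X · (β · s₂ k)
  s₁ zero    = const 0ℤ
  s₁ (suc k) = a · s₁ k ⊕ β · s₀ k
  s₂ zero    = const 0ℤ
  s₂ (suc k) = a · s₂ k ⊕ β · s₁ k

  section-φ^ : ∀ k → (section 0 (φ ^· k) ≈ s₀ k) × (section 1 (φ ^· k) ≈ s₁ k) × (section 2 (φ ^· k) ≈ s₂ k)
  section-φ^ zero =
    ≗⇒≈ (λ { zero → refl ; (suc _) → refl }) ,
    ≗⇒≈ (λ { zero → refl ; (suc _) → refl }) ,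
    ≗⇒≈ (λ { zero → refl ; (suc _) → refl })
  section-φ^ (suc k) with section-φ^ k
  ... | h₀ , h₁ , h₂ =
    ≈-trans (section-φ· 0 f) (+-cong
      (≈-trans (section₀-sub3-· a f) (*-cong ≈-refl h₀))
      (≈-trans (section₀-X· (sub3 β · f)) (*-cong ≈-refl (≈-trans (section₂-sub3-· β f) (*-cong ≈-refl h₂))))) ,
    ≈-trans (section-φ· 1 f) (+-cong
      (≈-trans (section₁-sub3-· a f) (*-cong ≈-refl h₁))
      (≈-trans (section₁-X· (sub3 β · f)) (≈-trans (section₀-sub3-· β f) (*-cong ≈-refl h₀)))) ,
    ≈-trans (section-φ· 2 f) (+-cong
      (≈-trans (section₂-sub3-· a f) (*-cong ≈-refl h₂))
      (≈-trans (section₂-X· (sub3 β · f)) (≈-trans (section₁-sub3-· β f) (*-cong ≈-refl h₁))))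
    where f = φ ^· k

  N : PS
  N = (a ^· 3) ⊕ (X · (β ^· 3))

  -- The recursion of `s₀`, `s₁`, `s₂` repeated in solver syntax: `p₀ k` evaluates to `s₀ k`, so the
  -- solver expands the power for a concrete k.
  module Polynomials {n : ℕ} (a′ x b : Solver.Polynomial n) where
    open Solver
    p₀ p₁ p₂ : ℕ → Polynomial n
    p₀ zero    = con 1ℤ
    p₀ (suc k) = a′ :* p₀ k :+ x :* (b :* p₂ k)
    p₁ zero    = con 0ℤ
    p₁ (suc k) = a′ :* p₁ k :+ b :* p₀ k
    p₂ zero    = con 0ℤ
    p₂ (suc k) = a′ :* p₂ k :+ b :* p₁ k

  -- This is `quartic-section` with U carried out: A is a series in q³, and so is B³ = q³ β(q³)³,
  -- although B is not.
  a·N≈φ⁴ : a · N ≈ φ ^· 4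
  a·N≈φ⁴ = begin
    a · N
      ≈⟨ solve 3 (λ a x b → a :* (a :^ 3 :+ x :* b :^ 3) :=
                            a :* (a :* (a :* a)) :+ a :* (x :* (b :* (b :* b)))) ≈-refl a X β ⟩
    a · (a · (a · a)) ⊕ a · (X · (β · (β · β)))
      ≈⟨ +-cong multiples (*-cong ≈-refl units) ⟨
    section 0 (A · (A · (A · A))) ⊕ a · section 0 (B · (B · B))
      ≈⟨ +-cong ≈-refl (section₀-sub3-· a (B · (B · B))) ⟨
    section 0 (A · (A · (A · A))) ⊕ section 0 (A · (B · (B · B)))
      ≈⟨ section-⊕ 0 _ _ ⟨
    section 0 ((A · (A · (A · A))) ⊕ (A · (B · (B · B))))
      ≈⟨ ≗⇒≈ quartic-section ⟩
    (φ · φ) · (φ · φ)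
      ≈⟨ solve 1 (λ p → (p :* p) :* (p :* p) := p :^ 4) ≈-refl φ ⟩
    φ ^· 4 ∎
    where
    open ≈-Reasoning
    open Solver
    A = φ-multiples
    B = φ-units
    multiples : section 0 (A · (A · (A · A))) ≈ a · (a · (a · a))
    multiples = ≈-trans (section₀-sub3-· a _) (*-cong ≈-refl
      (≈-trans (section₀-sub3-· a _) (*-cong ≈-refl
        (≈-trans (section₀-sub3-· a _) (*-cong ≈-refl (section-sub3 a))))))
    factor : ∀ i f → section i (B · f) ≈ section i (X · (sub3 β · f))
    factor i f = section-cong i (*-assoc X (sub3 β) f)
    units : section 0 (B · (B · B)) ≈ X · (β · (β · β))
    -- Each factor q of B moves the extracted class back by one, 0 to 2 to 1 to 0; only the first
    -- move wraps around and leaves a factor X.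
    units = begin
      section 0 (B · (B · B))              ≈⟨ factor 0 (B · B) ⟩
      section 0 (X · (sub3 β · (B · B)))   ≈⟨ section₀-X· _ ⟩
      X · section 2 (sub3 β · (B · B))     ≈⟨ *-cong ≈-refl (section₂-sub3-· β _) ⟩
      X · (β · section 2 (B · B))          ≈⟨ *-cong ≈-refl (*-cong ≈-refl (factor 2 B)) ⟩
      X · (β · section 2 (X · (sub3 β · B)))
                                           ≈⟨ *-cong ≈-refl (*-cong ≈-refl (section₂-X· _)) ⟩
      X · (β · section 1 (sub3 β · B))     ≈⟨ *-cong ≈-refl (*-cong ≈-refl (section₁-sub3-· β B)) ⟩
      X · (β · (β · section 1 B))          ≈⟨ *-cong ≈-refl (*-cong ≈-refl (*-cong ≈-refl (section₁-X· (sub3 β)))) ⟩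
      X · (β · (β · section 0 (sub3 β)))   ≈⟨ *-cong ≈-refl (*-cong ≈-refl (*-cong ≈-refl (section-sub3 β))) ⟩
      X · (β · (β · β))                    ∎

  φ³·p̄≈1 : (φ ^· 3) · p̄ ≈ one
  φ³·p̄≈1 = ≗⇒≈ λ n → trans (·≗⊛ (φ ^· 3) p̄ n)
    (trans (⊛-cong {g = p̄} (λ k → sym (^^≗^· φ 3 k)) (λ _ → refl) n) (φ³⊛pbar3 n))

  drop-multiple : ∀ {f g} h → f ≈ g ⊕ const (+ m) · h → f ≈ g
  drop-multiple {f} {g} h eq = ≈-trans eq (≈-trans (+-cong ≈-refl (const-multiple≈0 h)) (+-identityʳ g))

-- An exact equation can be raised to a power and then read modulo a larger number.
difference : ∀ {m f g} → f ≈[ m ] g → ∃ λ e → f ≗ g ⊕ const (+ m) · e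
difference {m} {f} {g} h = e , λ n → begin
  f n                             ≡⟨ restore (f n) (g n) ⟩
  g n ℤ.+ (f n ℤ.- g n)           ≡⟨ cong (λ z → g n ℤ.+ z) (Signed._∣_.equality (m∣f-g n)) ⟩
  g n ℤ.+ e n *ℤ + m              ≡⟨ cong (λ z → g n ℤ.+ z) (ℤₚ.*-comm (e n) (+ m)) ⟩
  g n ℤ.+ + m *ℤ e n              ≡⟨ cong (λ z → g n ℤ.+ z) (trans (·≗⊛ (const (+ m)) e n) (const-⊛ (+ m) e n)) ⟨
  g n ℤ.+ (const (+ m) · e) n     ≡⟨ ⊕≗∔ g (const (+ m) · e) n ⟨
  (g ⊕ const (+ m) · e) n         ∎
  where
  open ≡-Reasoning
  m∣f-g : ∀ n → (+ m) Signed.∣ (f n ℤ.- g n)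
  m∣f-g n = Signed.∣ᵤ⇒∣ (coeff h n)
  e : PS
  e n = Signed._∣_.quotient (m∣f-g n)
  restore : ∀ x y → x ≡ y ℤ.+ (x ℤ.- y)
  restore = solve-∀

-- Cubes modulo 3 and the lifts to 9 and 8

fermat-3 : ∀ c → + 3 Signed.∣ (c *ℤ (c *ℤ c) ℤ.- c)
fermat-3 (+ n) = nonnegative n
  where
  nonnegative : ∀ n → + 3 Signed.∣ ((+ n) *ℤ ((+ n) *ℤ (+ n)) ℤ.- + n)
  nonnegative zero    = Signed.divides 0ℤ refl
  nonnegative (suc n) = subst (+ 3 Signed.∣_) (step (+ n))
    (Signed.∣m∣n⇒∣m+n (nonnegative n) (Signed.∣m⇒∣m*n ((+ n) *ℤ (+ n) ℤ.+ + n) Signed.∣-refl))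
    where
    step : ∀ c → (c *ℤ (c *ℤ c) ℤ.- c) ℤ.+ + 3 *ℤ (c *ℤ c ℤ.+ c) ≡
                 (1ℤ ℤ.+ c) *ℤ ((1ℤ ℤ.+ c) *ℤ (1ℤ ℤ.+ c)) ℤ.- (1ℤ ℤ.+ c)
    step = solve-∀
fermat-3 c@(-[1+ n ]) = subst (+ 3 Signed.∣_) (negate (+ suc n)) (Signed.∣m⇒∣-m (fermat-3 (+ suc n)))
  where
  negate : ∀ c → - (c *ℤ (c *ℤ c) ℤ.- c) ≡ (- c) *ℤ ((- c) *ℤ (- c)) ℤ.- (- c)
  negate = solve-∀

module Frobenius where
  open Congruence 3
  open Sections 3 using (drop-multiple)

  split-constant : ∀ f → f ≗ const (f 0) ⊕ X · (f ∘ suc)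
  split-constant f n = trans (pointwise n) (sym (⊕≗∔ (const (f 0)) (X · (f ∘ suc)) n))
    where
    pointwise : ∀ n → f n ≡ const (f 0) n ℤ.+ (X · (f ∘ suc)) n
    pointwise zero    = sym (trans (cong (λ z → f 0 ℤ.+ z) (·≗⊛ X (f ∘ suc) 0)) (ℤₚ.+-identityʳ (f 0)))
    pointwise (suc n) = sym (trans (ℤₚ.+-identityˡ _) (trans (·≗⊛ X (f ∘ suc) (suc n)) (X-⊛ (f ∘ suc) (suc n))))

  cube-split : ∀ f → f ^· 3 ≈ const (f 0) · (const (f 0) · const (f 0)) ⊕ X · (X · (X · (f ∘ suc) ^· 3))
  cube-split f = ≈-trans
    (*-cong f≈ (*-cong f≈ (*-cong f≈ ≈-refl)))
    (drop-multiple ((C · C) · (X · f′) ⊕ C · ((X · f′) · (X · f′)))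
      (solve 3 (λ c x f →
         (c :+ x :* f) :^ 3 :=
         c :* (c :* c) :+ x :* (x :* (x :* f :^ 3)) :+
         con (+ 3) :* ((c :* c) :* (x :* f) :+ c :* ((x :* f) :* (x :* f)))) ≈-refl C X f′))
    where
    open Solver
    C = const (f 0)
    f′ = f ∘ suc
    f≈ : f ≈ C ⊕ X · f′
    f≈ = ≗⇒≈ (split-constant f)

  private
    _≡₃_ : ℤ → ℤ → Set
    x ≡₃ y = + 3 Signed.∣ (x ℤ.- y)

    ≡₃-trans : ∀ {x y z} → x ≡₃ y → y ≡₃ z → x ≡₃ z
    ≡₃-trans {x} {y} {z} p q = subst (+ 3 Signed.∣_) (telescope x y z) (Signed.∣m∣n⇒∣m+n p q)
      where
      telescope : ∀ x y z → (x ℤ.- y) ℤ.+ (y ℤ.- z) ≡ x ℤ.- z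
      telescope = solve-∀

    sub3-shift : ∀ f n → sub3 f (3 ℕ.+ n) ≡ sub3 (f ∘ suc) n
    sub3-shift f = residue-cases _
      (λ k → trans (sub3-0 f (suc k)) (sym (sub3-0 (f ∘ suc) k)))
      (λ k → trans (sub3-1 f (suc k)) (sym (sub3-1 (f ∘ suc) k)))
      (λ k → trans (sub3-2 f (suc k)) (sym (sub3-2 (f ∘ suc) k)))

    X·-zero : ∀ f → (X · f) 0 ≡ 0ℤ
    X·-zero f = ·≗⊛ X f 0

    X·-suc : ∀ f n → (X · f) (suc n) ≡ f n
    X·-suc f n = trans (·≗⊛ X f (suc n)) (X-⊛ f (suc n))

    const-· : ∀ c f n → (const c · f) n ≡ c *ℤ f n
    const-· c f n = trans (·≗⊛ (const c) f n) (const-⊛ c f n)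

    cube-constant : ∀ c n → (const c · (const c · const c)) n ≡ c *ℤ (c *ℤ const c n)
    cube-constant c n = trans (const-· c (const c · const c) n) (cong (λ z → c *ℤ z) (const-· c (const c) n))

    cube-constant-suc : ∀ c n → (const c · (const c · const c)) (suc n) ≡ 0ℤ
    cube-constant-suc c n =
      trans (cube-constant c (suc n)) (trans (cong (c *ℤ_) (ℤₚ.*-zeroʳ c)) (ℤₚ.*-zeroʳ c))

    -- By `cube-split`, (c + X g)³ ≡ c³ + X³ g³, so degree 3 + n for f reduces to degree n for its
    -- tail g; `fermat-3` settles the constant term.
    frobenius-coeff : ∀ n f → (f ^· 3) n ≡₃ sub3 f n
    frobenius-coeff n f = ≡₃-trans {(f ^· 3) n} {(C³ ⊕ Y) n} {sub3 f n}
      (Signed.∣ᵤ⇒∣ (coeff (cube-split f) n)) (subst (_≡₃ sub3 f n) (sym (⊕≗∔ C³ Y n)) (compare n))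
      where
      C³ Y : PS
      C³ = const (f 0) · (const (f 0) · const (f 0))
      Y = X · (X · (X · (f ∘ suc) ^· 3))
      vanish : ∀ {x y z} → x ≡ 0ℤ → y ≡ 0ℤ → z ≡ 0ℤ → (x ℤ.+ y) ≡₃ z
      vanish refl refl refl = Signed.divides 0ℤ refl
      compare : ∀ n → (C³ n ℤ.+ Y n) ≡₃ sub3 f n
      compare 0 = subst₂ _≡₃_
        (sym (add-zero (cube-constant (f 0) 0) (X·-zero _))) (sym (sub3-0 f 0))
        (fermat-3 (f 0))
      compare 1 = vanish (cube-constant-suc (f 0) 0) (trans (X·-suc _ 0) (X·-zero _)) (sub3-1 f 0)
      compare 2 = vanish (cube-constant-suc (f 0) 1) (trans (X·-suc _ 1) (trans (X·-suc _ 0) (X·-zero _))) (sub3-2 f 0)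
      compare (suc (suc (suc n))) = subst₂ _≡₃_
        (sym (trans (ℤₚ.+-comm (C³ (3 ℕ.+ n)) (Y (3 ℕ.+ n))) (add-zero
          (trans (X·-suc _ (2 ℕ.+ n)) (trans (X·-suc _ (suc n)) (X·-suc _ n))) (cube-constant-suc (f 0) (2 ℕ.+ n)))))
        (sym (sub3-shift f n))
        (frobenius-coeff n (f ∘ suc))

  frobenius : ∀ f → f ^· 3 ≈ sub3 f
  frobenius f = congruent λ n → Signed.∣⇒∣ᵤ (frobenius-coeff n f)

-- In (g + 3e)³ the terms after g³ are 9g²e, 27ge² and 27e³, all multiples of 9.
cube-lift : ∀ {f g} → f ≈[ 3 ] g → f ^· 3 ≈[ 9 ] g ^· 3
cube-lift {f} {g} h with difference h
... | e , f≗ = drop-multiple (g · (g · e) ⊕ const (+ 3) · (g · (e · e)) ⊕ const (+ 3) · (e · (e · e)))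
  (≈-trans (*-cong f≈ (*-cong f≈ (*-cong f≈ ≈-refl)))
    (solve 2 (λ g e → (g :+ con (+ 3) :* e) :^ 3 :=
      g :^ 3 :+ con (+ 9) :* (g :* (g :* e) :+ con (+ 3) :* (g :* (e :* e)) :+ con (+ 3) :* (e :* (e :* e)))) ≈-refl g e))
  where
  open Congruence 9
  open Sections 9
  open Solver
  f≈ : f ≈ g ⊕ const (+ 3) · e
  f≈ = ≗⇒≈ f≗

-- The coefficients of (1 + 2e)⁴ after the first are 8, 24, 32, 16. A square would reach only the
-- modulus 4, as e + e² need not be even for a series e.
fourth-lift : ∀ {f} → f ≈[ 2 ] one → f ^· 4 ≈[ 8 ] one
fourth-lift {f} h with difference h
... | e , f≗ = drop-multiple (e ⊕ const (+ 3) · (e · e) ⊕ const (+ 4) · (e · (e · e)) ⊕ const (+ 2) · (e ^· 4))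
  (≈-trans (*-cong f≈ (*-cong f≈ (*-cong f≈ (*-cong f≈ ≈-refl))))
    (≈-trans (solve 1 (λ e → (con 1ℤ :+ con (+ 2) :* e) :^ 4 :=
      con 1ℤ :+ con (+ 8) :* (e :+ con (+ 3) :* (e :* e) :+ con (+ 4) :* (e :* (e :* e)) :+ con (+ 2) :* e :^ 4)) ≈-refl e)
      (+-cong (≈-sym (≗⇒≈ one≗const)) ≈-refl)))
  where
  open Congruence 8
  open Sections 8
  open Solver
  f≈ : f ≈ const 1ℤ ⊕ const (+ 2) · e
  f≈ = ≈-trans (≗⇒≈ f≗) (+-cong (≗⇒≈ one≗const) ≈-refl)

-- Nonzero k and -k have the same square, so each j > 0 contributes 0 or 2.
φ-odd : φ ≈[ 2 ] one
φ-odd = congruent λ n → Signed.∣⇒∣ᵤ (partial n n)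
  where
  even-term : ∀ n j → + 2 Signed.∣ φ-term n (suc j)
  even-term n j with does (suc j ℕ.* suc j ≟ n)
  ... | true  = Signed.∣-refl
  ... | false = Signed.divides 0ℤ refl
  first : ∀ n → + 2 Signed.∣ (φ-term n 0 ℤ.- one n)
  first zero    = Signed.divides 0ℤ refl
  first (suc _) = Signed.divides 0ℤ refl
  regroup : ∀ x y z → (x ℤ.- z) ℤ.+ y ≡ (x ℤ.+ y) ℤ.- z
  regroup = solve-∀
  partial : ∀ N n → + 2 Signed.∣ (sumTo N (φ-term n) ℤ.- one n)
  partial zero    n = first n
  partial (suc N) n = subst (+ 2 Signed.∣_) (regroup (sumTo N (φ-term n)) (φ-term n (suc N)) (one n))
    (Signed.∣m∣n⇒∣m+n (partial N n) (even-term n N))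

φ⁹≈a³ : (φ ^· 3) ^· 3 ≈[ 9 ] a ^· 3
φ⁹≈a³ = cube-lift (Frobenius.frobenius φ)

φ⁴≈1 : φ ^· 4 ≈[ 8 ] one
φ⁴≈1 = fourth-lift φ-odd

a⁴≈1 : a ^· 4 ≈[ 8 ] one
a⁴≈1 = fourth-lift (≈-trans (sub3-cong≈ φ-odd) (≗⇒≈ sub3-one))
  where
  open Congruence 2
  open Sections 2

-- Iteration of U

scaled : ℕ → PS → PS
scaled k f n = f (3 ^ k ℕ.* n)

scaled-suc : ∀ k f → scaled (suc k) f ≗ section 0 (scaled k f)
scaled-suc k f n = cong f (rearrange (3 ^ k) n)
  where
  rearrange : ∀ p n → 3 ℕ.* p ℕ.* n ≡ p ℕ.* (n ℕ.* 3)
  rearrange = ℕ-solve-∀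

-- The cycle is entered at the second application of U. Modulo 9 the first one gives φ⁵/a², which
-- lies outside the cycle, whence the start at α = 1.
module Alternation {m : ℕ} (f even odd : PS)
  (section²-f : section 0 (section 0 f) ≈[ m ] even)
  (even→odd : section 0 even ≈[ m ] odd)
  (odd→even : section 0 odd ≈[ m ] even) where

  open Congruence m
  open Sections m

  scaled-even : ∀ α → scaled (2 ℕ.* suc α) f ≈ even
  scaled-odd  : ∀ α → scaled (2 ℕ.* suc α ℕ.+ 1) f ≈ odd

  scaled-even zero    = ≈-trans (≗⇒≈ (scaled-suc 1 f)) (≈-trans
    (section-cong 0 (≈-trans (≗⇒≈ (scaled-suc 0 f)) (section-cong 0 (≗⇒≈ λ n → cong f (ℕₚ.+-identityʳ n)))))
    section²-f)
  scaled-even (suc α) = subst (λ k → scaled k f ≈ even) (exponent α)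
    (≈-trans (≗⇒≈ (scaled-suc (2 ℕ.* suc α ℕ.+ 1) f))
      (≈-trans (section-cong 0 (scaled-odd α)) odd→even))
    where
    exponent : ∀ α → suc (2 ℕ.* suc α ℕ.+ 1) ≡ 2 ℕ.* suc (suc α)
    exponent = ℕ-solve-∀
  scaled-odd α = subst (λ k → scaled k f ≈ odd) (ℕₚ.+-comm 1 (2 ℕ.* suc α))
    (≈-trans (≗⇒≈ (scaled-suc (2 ℕ.* suc α) f))
      (≈-trans (section-cong 0 (scaled-even α)) even→odd))

R₁ R₂ : PS
R₁ = a ^· 4 · inv (φ ^^ 7)
R₂ = a ^· 5 · inv (φ ^^ 8)

module Modulo8 where
  open Congruence 8
  open Sections 8
  open Solver
  open ≈-Reasoning

  section-φ : section 0 φ ≈ a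
  section-φ = ≗⇒≈ φ-3n

  p̄≈φ : p̄ ≈ φ
  p̄≈φ = begin
    p̄                        ≈⟨ *-identityˡ p̄ ⟨
    one · p̄                  ≈⟨ *-cong φ⁴≈1 ≈-refl ⟨
    φ ^· 4 · p̄               ≈⟨ *-assoc φ (φ ^· 3) p̄ ⟩
    φ · (φ ^· 3 · p̄)         ≈⟨ *-cong ≈-refl φ³·p̄≈1 ⟩
    φ · one                  ≈⟨ *-identityʳ φ ⟩
    φ                        ∎

  φ⁸≈1 : φ ^· 8 ≈ one
  φ⁸≈1 = begin
    φ ^· 8                 ≈⟨ solve 1 (λ p → p :^ 8 := p :^ 4 :* p :^ 4) ≈-refl φ ⟩
    φ ^· 4 · φ ^· 4        ≈⟨ *-cong φ⁴≈1 φ⁴≈1 ⟩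
    one · one              ≈⟨ *-identityˡ one ⟩
    one                    ∎

  -- From φ⁸ ≡ 1 the inverse of φ⁷ is φ itself, and a⁴ drops out.
  R₁≈φ : R₁ ≈ φ
  R₁≈φ = begin
    a ^· 4 · h                 ≈⟨ *-cong a⁴≈1 ≈-refl ⟩
    one · h                    ≈⟨ *-cong φ⁸≈1 ≈-refl ⟨
    φ ^· 8 · h                 ≈⟨ *-assoc φ (φ ^· 7) h ⟩
    φ · (φ ^· 7 · h)           ≈⟨ *-cong ≈-refl (·-inv 8 φ 7 refl) ⟩
    φ · one                    ≈⟨ *-identityʳ φ ⟩
    φ                          ∎
    where h = inv (φ ^^ 7)

  R₂≈a : R₂ ≈ a
  R₂≈a = begin
    (a · a ^· 4) · h           ≈⟨ *-cong (*-cong ≈-refl a⁴≈1) ≈-refl ⟩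
    (a · one) · h              ≈⟨ *-cong (*-identityʳ a) (≈-sym (*-identityˡ h)) ⟩
    a · (one · h)              ≈⟨ *-cong ≈-refl (*-cong φ⁸≈1 ≈-refl) ⟨
    a · (φ ^· 8 · h)           ≈⟨ *-cong ≈-refl (·-inv 8 φ 8 refl) ⟩
    a · one                    ≈⟨ *-identityʳ a ⟩
    a                          ∎
    where h = inv (φ ^^ 8)

  section²-p̄ : section 0 (section 0 p̄) ≈ φ
  section²-p̄ = ≈-trans (section-cong 0 (≈-trans (section-cong 0 p̄≈φ) section-φ)) (section-sub3 φ)

  even : ∀ α → scaled (2 ℕ.* suc α) p̄ ≈ R₁
  even α = ≈-trans (Alternation.scaled-even p̄ φ a section²-p̄ section-φ (section-sub3 φ) α) (≈-sym R₁≈φ)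

  odd : ∀ α → scaled (2 ℕ.* suc α ℕ.+ 1) p̄ ≈ R₂
  odd α = ≈-trans (Alternation.scaled-odd p̄ φ a section²-p̄ section-φ (section-sub3 φ) α) (≈-sym R₂≈a)

module Modulo9 where
  open Congruence 9
  open Sections 9
  open Solver
  open ≈-Reasoning

  -- The inverses of φ and of a. Writing 1/a as `sub3 ι` lets U pass it, turning κ into ι.
  ι κ : PS
  ι = inv φ
  κ = sub3 ι

  φ·ι≈1 : φ · ι ≈ one
  φ·ι≈1 = ≗⇒≈ λ n → trans (·≗⊛ φ ι n) (⊛-inv φ refl n)

  a·κ≈1 : a · κ ≈ one
  a·κ≈1 = ≗⇒≈ λ n → trans (·≗⊛ a κ n) (trans (sub3-⊛ φ ι n) (trans (sub3-cong (⊛-inv φ refl) n) (sub3-one n)))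

  section-φ² : section 0 (φ ^· 2) ≈ a · a
  section-φ² = ≈-trans (proj₁ (section-φ^ 2))
    (solve 3 (λ a x b → Polynomials.p₀ a x b 2 := a :* a) ≈-refl a X β)

  -- Exactly a⁵ + 10 a² X β³, and the binomial coefficient 10 is 1 modulo 9.
  section-φ⁵ : section 0 (φ ^· 5) ≈ a · (a · N)
  section-φ⁵ = ≈-trans (proj₁ (section-φ^ 5)) (drop-multiple (a · (a · (X · β ^· 3)))
    (solve 3 (λ a x b → Polynomials.p₀ a x b 5 :=
      a :* (a :* (a :^ 3 :+ x :* b :^ 3)) :+ con (+ 9) :* (a :* (a :* (x :* b :^ 3)))) ≈-refl a X β))

  -- Exactly a⁶ + 20 a³ X β³ + X² β⁶; the binomial coefficient 20 is 2 modulo 9, which completes the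
  -- square of N.
  section-φ⁶ : section 0 (φ ^· 6) ≈ N · N
  section-φ⁶ = ≈-trans (proj₁ (section-φ^ 6)) (drop-multiple (const (+ 2) · (a ^· 3 · (X · β ^· 3)))
    (solve 3 (λ a x b → Polynomials.p₀ a x b 6 :=
      (a :^ 3 :+ x :* b :^ 3) :* (a :^ 3 :+ x :* b :^ 3)
        :+ con (+ 9) :* (con (+ 2) :* (a :^ 3 :* (x :* b :^ 3)))) ≈-refl a X β))

  N≈κφ⁴ : N ≈ κ · φ ^· 4
  N≈κφ⁴ = begin
    N                    ≈⟨ *-identityˡ N ⟨
    one · N              ≈⟨ *-cong a·κ≈1 ≈-refl ⟨
    (a · κ) · N          ≈⟨ solve 3 (λ a k n → (a :* k) :* n := k :* (a :* n)) ≈-refl a κ N ⟩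
    κ · (a · N)          ≈⟨ *-cong ≈-refl a·N≈φ⁴ ⟩
    κ · φ ^· 4           ∎

  p̄≈κ³φ⁶ : p̄ ≈ κ · (κ · (κ · φ ^· 6))
  p̄≈κ³φ⁶ = begin
    p̄                                        ≈⟨ solve 1 (λ g → con 1ℤ :* (con 1ℤ :* (con 1ℤ :* g)) := g) ≈-refl p̄ ⟨
    -- Inserting (aκ)³ = 1 makes a³ available to be replaced by φ⁹, of which φ³ cancels against
    -- `p̄`.
    const 1ℤ · (const 1ℤ · (const 1ℤ · p̄))   ≈⟨ *-cong aκ (*-cong aκ (*-cong aκ ≈-refl)) ⟨
    (a · κ) · ((a · κ) · ((a · κ) · p̄))      ≈⟨ solve 3 (λ a k g → (a :* k) :* ((a :* k) :* ((a :* k) :* g)) :=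
                                                          a :^ 3 :* (k :^ 3 :* g)) ≈-refl a κ p̄ ⟩
    a ^· 3 · (κ ^· 3 · p̄)                    ≈⟨ *-cong φ⁹≈a³ ≈-refl ⟨
    (φ ^· 3) ^· 3 · (κ ^· 3 · p̄)             ≈⟨ solve 3 (λ p k g → (p :^ 3) :^ 3 :* (k :^ 3 :* g) :=
                                                          k :* (k :* (k :* p :^ 6)) :* (p :^ 3 :* g)) ≈-refl φ κ p̄ ⟩
    (κ · (κ · (κ · φ ^· 6))) · (φ ^· 3 · p̄)  ≈⟨ *-cong ≈-refl φ³·p̄≈1 ⟩
    (κ · (κ · (κ · φ ^· 6))) · one           ≈⟨ *-identityʳ _ ⟩
    κ · (κ · (κ · φ ^· 6))                   ∎
    where
    aκ : a · κ ≈ const 1ℤ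
    aκ = ≈-trans a·κ≈1 (≗⇒≈ one≗const)

  -- With N = φ⁴/a, the quotient N²/φ³ becomes φ⁵/a²: again a positive power of φ over a series in
  -- q³, ready for another U.
  section-p̄ : section 0 p̄ ≈ κ · (κ · φ ^· 5)
  section-p̄ = begin
    section 0 p̄                                      ≈⟨ section-cong 0 p̄≈κ³φ⁶ ⟩
    section 0 (κ · (κ · (κ · φ ^· 6)))               ≈⟨ section₀-sub3-· ι _ ⟩
    ι · section 0 (κ · (κ · φ ^· 6))                 ≈⟨ *-cong ≈-refl (section₀-sub3-· ι _) ⟩
    ι · (ι · section 0 (κ · φ ^· 6))                 ≈⟨ *-cong ≈-refl (*-cong ≈-refl (section₀-sub3-· ι _)) ⟩
    ι · (ι · (ι · section 0 (φ ^· 6)))               ≈⟨ *-cong ≈-refl (*-cong ≈-refl (*-cong ≈-refl section-φ⁶)) ⟩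
    ι · (ι · (ι · (N · N)))                          ≈⟨ *-cong ≈-refl (*-cong ≈-refl (*-cong ≈-refl (*-cong N≈κφ⁴ N≈κφ⁴))) ⟩
    ι · (ι · (ι · ((κ · φ ^· 4) · (κ · φ ^· 4))))    ≈⟨ solve 3 (λ i k p → i :* (i :* (i :* ((k :* p :^ 4) :* (k :* p :^ 4)))) :=
                                                          (p :* i) :* ((p :* i) :* ((p :* i) :* (k :* (k :* p :^ 5))))) ≈-refl ι κ φ ⟩
    (φ · ι) · ((φ · ι) · ((φ · ι) · (κ · (κ · φ ^· 5))))
                                                     ≈⟨ *-cong φι (*-cong φι (*-cong φι ≈-refl)) ⟩
    const 1ℤ · (const 1ℤ · (const 1ℤ · (κ · (κ · φ ^· 5))))
                                                     ≈⟨ solve 1 (λ g → con 1ℤ :* (con 1ℤ :* (con 1ℤ :* g)) := g) ≈-refl _ ⟩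
    κ · (κ · φ ^· 5)                                 ∎
    where
    φι : φ · ι ≈ const 1ℤ
    φι = ≈-trans φ·ι≈1 (≗⇒≈ one≗const)

  section²-p̄ : section 0 (section 0 p̄) ≈ a · φ ^· 2
  section²-p̄ = begin
    section 0 (section 0 p̄)                ≈⟨ section-cong 0 section-p̄ ⟩
    section 0 (κ · (κ · φ ^· 5))           ≈⟨ section₀-sub3-· ι _ ⟩
    ι · section 0 (κ · φ ^· 5)             ≈⟨ *-cong ≈-refl (section₀-sub3-· ι _) ⟩
    ι · (ι · section 0 (φ ^· 5))           ≈⟨ *-cong ≈-refl (*-cong ≈-refl section-φ⁵) ⟩
    ι · (ι · (a · (a · N)))                ≈⟨ *-cong ≈-refl (*-cong ≈-refl (*-cong ≈-refl a·N≈φ⁴)) ⟩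
    ι · (ι · (a · φ ^· 4))                 ≈⟨ solve 3 (λ i a p → i :* (i :* (a :* p :^ 4)) :=
                                                (p :* i) :* ((p :* i) :* (a :* p :^ 2))) ≈-refl ι a φ ⟩
    (φ · ι) · ((φ · ι) · (a · φ ^· 2))     ≈⟨ *-cong φ·ι≈1 (*-cong φ·ι≈1 ≈-refl) ⟩
    one · (one · (a · φ ^· 2))             ≈⟨ ≈-trans (*-identityˡ _) (*-identityˡ _) ⟩
    a · φ ^· 2                             ∎

  even→odd : section 0 (a · φ ^· 2) ≈ a · (a · φ)
  even→odd = begin
    section 0 (a · φ ^· 2)     ≈⟨ section₀-sub3-· φ _ ⟩
    φ · section 0 (φ ^· 2)     ≈⟨ *-cong ≈-refl section-φ² ⟩
    φ · (a · a)                ≈⟨ solve 2 (λ p a → p :* (a :* a) := a :* (a :* p)) ≈-refl φ a ⟩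
    a · (a · φ)                ∎

  odd→even : section 0 (a · (a · φ)) ≈ a · φ ^· 2
  odd→even = begin
    section 0 (a · (a · φ))    ≈⟨ section₀-sub3-· φ _ ⟩
    φ · section 0 (a · φ)      ≈⟨ *-cong ≈-refl (section₀-sub3-· φ φ) ⟩
    φ · (φ · section 0 φ)      ≈⟨ *-cong ≈-refl (*-cong ≈-refl (≗⇒≈ φ-3n)) ⟩
    φ · (φ · a)                ≈⟨ solve 2 (λ p a → p :* (p :* a) := a :* p :^ 2) ≈-refl φ a ⟩
    a · φ ^· 2                 ∎

  -- Trading a³ for φ⁹ in the numerator clears the denominator φ⁷ and leaves φ².
  R₁≈aφ² : R₁ ≈ a · φ ^· 2
  R₁≈aφ² = begin
    a ^· 4 · h                             ≈⟨ *-assoc a (a ^· 3) h ⟩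
    a · (a ^· 3 · h)                       ≈⟨ *-cong ≈-refl (*-cong φ⁹≈a³ ≈-refl) ⟨
    a · ((φ ^· 3) ^· 3 · h)                ≈⟨ solve 3 (λ a p h → a :* ((p :^ 3) :^ 3 :* h) :=
                                                (a :* p :^ 2) :* (p :^ 7 :* h)) ≈-refl a φ h ⟩
    (a · φ ^· 2) · (φ ^· 7 · h)            ≈⟨ *-cong ≈-refl (·-inv 9 φ 7 refl) ⟩
    (a · φ ^· 2) · one                     ≈⟨ *-identityʳ _ ⟩
    a · φ ^· 2                             ∎
    where h = inv (φ ^^ 7)

  R₂≈a²φ : R₂ ≈ a · (a · φ)
  R₂≈a²φ = begin
    a ^· 5 · h                             ≈⟨ solve 2 (λ a h → a :^ 5 :* h := a :* (a :* (a :^ 3 :* h))) ≈-refl a h ⟩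
    a · (a · (a ^· 3 · h))                 ≈⟨ *-cong ≈-refl (*-cong ≈-refl (*-cong φ⁹≈a³ ≈-refl)) ⟨
    a · (a · ((φ ^· 3) ^· 3 · h))          ≈⟨ solve 3 (λ a p h → a :* (a :* ((p :^ 3) :^ 3 :* h)) :=
                                                (a :* (a :* p)) :* (p :^ 8 :* h)) ≈-refl a φ h ⟩
    (a · (a · φ)) · (φ ^· 8 · h)           ≈⟨ *-cong ≈-refl (·-inv 9 φ 8 refl) ⟩
    (a · (a · φ)) · one                    ≈⟨ *-identityʳ _ ⟩
    a · (a · φ)                            ∎
    where h = inv (φ ^^ 8)

  even : ∀ α → scaled (2 ℕ.* suc α) p̄ ≈ R₁
  even α = ≈-trans (Alternation.scaled-even p̄ (a · φ ^· 2) (a · (a · φ)) section²-p̄ even→odd odd→even α) (≈-sym R₁≈aφ²)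

  odd : ∀ α → scaled (2 ℕ.* suc α ℕ.+ 1) p̄ ≈ R₂
  odd α = ≈-trans (Alternation.scaled-odd p̄ (a · φ ^· 2) (a · (a · φ)) section²-p̄ even→odd odd→even α) (≈-sym R₂≈a²φ)

-- From the moduli 8 and 9 to 72

8∣9∣⇒72∣ : ∀ {n} → 8 ℕ∣.∣ n → 9 ℕ∣.∣ n → 72 ℕ∣.∣ n
8∣9∣⇒72∣ 8∣n (ℕ∣.divides q refl)
  with coprime-divisor {8} {9} {q} (from-yes (coprime? 8 9)) (subst (8 ℕ∣.∣_) (ℕₚ.*-comm q 9) 8∣n)
... | ℕ∣.divides r refl = ℕ∣.divides r (ℕₚ.*-assoc r 8 9)

sgn-3^ : ∀ k n → sgn (3 ^ k ℕ.* n) ≡ sgn n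
sgn-3^ zero    n = cong sgn (ℕₚ.+-identityʳ n)
sgn-3^ (suc k) n = trans (cong sgn (rearrange (3 ^ k) n)) (trans (sgn-*3 (3 ^ k ℕ.* n)) (sgn-3^ k n))
  where
  rearrange : ∀ p n → 3 ℕ.* p ℕ.* n ≡ p ℕ.* n ℕ.* 3
  rearrange = ℕ-solve-∀

-- The series `scaled k p̄` carries the sign of 3^k n, which equals that of n, as in the theorem.
combine : ∀ k j {h} → scaled k p̄ ≈[ 8 ] a ^· j · h → scaled k p̄ ≈[ 9 ] a ^· j · h →
           (λ n → sgn n *ℤ pbar3 (3 ^ k ℕ.* n)) ≡[mod 72 ] (a ^^ j) ⊛ h
combine k j {h} mod8 mod9 n = subst₂ (λ x y → 72 ℕ∣.∣ ∣ x ℤ.- y ∣)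
  (cong (_*ℤ pbar3 (3 ^ k ℕ.* n)) (sgn-3^ k n))
  (trans (·≗⊛ (a ^· j) h n) (⊛-cong {g = h} (λ i → sym (^^≗^· a j i)) (λ _ → refl) n))
  (8∣9∣⇒72∣ (coeff mod8 n) (coeff mod9 n))

theorem3p6 : (α : ℕ) → 1 ≤ α →
    ((λ n → sgn n *ℤ pbar3 (3 ^ (2 * α) * n))
    ≡[mod 9 * 2 ^ 3 ] (sub3 φ ^^ 4 ⊛ inv (φ ^^ 7)))
    × ((λ n → sgn n *ℤ pbar3 (3 ^ (2 * α + 1) * n))
    ≡[mod 9 * 2 ^ 3 ] (sub3 φ ^^ 5 ⊛ inv (φ ^^ 8)))
theorem3p6 (suc α) _ =
  combine (2 * suc α) 4 (Modulo8.even α) (Modulo9.even α) ,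
  combine (2 * suc α + 1) 5 (Modulo8.odd α) (Modulo9.odd α)
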